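{- Let $S=\{3^x+2^y : x,y\in\mathbb{Z}_{\ge 0}\}$. There do not exist integers $a$ and $d$ with $d\neq 0$ such that $a+kd\in S$ for all $k=0,1,\dots,6$. In other words, every arithmetic progression with nonzero common difference all of whose terms lie in $S$ has at most six terms.
   Context: $\mathbb{Z}_{\ge 0}$ denotes the set of nonnegative integers. An arithmetic progression of length $L$ is a sequence $a, a+d, \dots, a+(L-1)d$ of integers; here the common difference $d$ is required to be nonzero. -}

module Defs where

open import Data.Nat using (ℕ)
open import Data.Integer using (ℤ; +_)
open import Data.Product using (∃₂)
open import Relation.Binary.PropositionalEquality using (_≡_)
import Data.Nat as N

InS : ℤ → Set
InS n = ∃₂ λ (x y : ℕ) → n ≡ + (3 N.^ x N.+ 2 N.^ y)

{-# OPTIONS --safe #-}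

-- Let t₀, …, t₆ be the terms, with d > 0.  Residues modulo 24 together with size
-- considerations force 12 ∣ d.  Then t mod 12 is constant, which fixes the residue of 3^x
-- modulo 8 and that of 2^y modulo 3 in every representation t = 3^x + 2^y, apart from terms
-- of the shapes 1 + 2^y and 3^x + 2.  So powers of 3 (of 2) occurring in ordinary terms are
-- equal or differ by a factor of at least 9 (at least 4).  Since t₃, …, t₆ lie within a
-- factor 2 of each other, ordinary terms dominated by the same base share the dominating
-- power, and the other summands then grow too fast for three of them.  The few remaining
-- patterns for t₃, …, t₆ are refuted one by one, mostly by linear inequalities; in the
-- surviving patterns t₂ or a congruence modulo 8, 9 or 80 decides.
module Submission where

open import Defs
open import Data.Nat as N using (ℕ; zero; suc; _<_; _≤_; _>_; _^_; _%_; _/_; _∸_; NonZero; s≤s;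
  z≤n; z<s)
open import Data.Empty using (⊥; ⊥-elim)
open import Data.Fin using (Fin; toℕ; fromℕ<)
open import Data.Fin.Properties as Fin using (toℕ-fromℕ<)
open import Data.List using (List; []; _∷_)
open import Data.List.Membership.Propositional using (_∈_)
open import Data.List.Membership.DecPropositional N._≟_ using (_∈?_)
open import Data.List.Relation.Unary.All as All using (all?)
open import Data.List.Relation.Unary.Any using (here; there)
open import Data.Nat.Divisibility
open import Data.Nat.DivMod
open import Data.Nat.Properties
open import Data.Nat.Tactic.RingSolver using (solve)
open import Data.Product using (∃; ∃₂; _×_; _,_)
open import Data.Sum using (_⊎_; inj₁; inj₂)
open import Relation.Binary.PropositionalEquality
  using (_≡_; _≢_; refl; sym; trans; cong; cong₂; subst; subst₂; module ≡-Reasoning)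
open import Relation.Binary.Definitions using (Tri; tri<; tri≈; tri>)
open import Relation.Nullary using (¬_)
open import Relation.Nullary.Decidable
  using (Dec; no; True; toWitness; fromWitness; from-no; from-yes; _×-dec_; _⊎-dec_; _→-dec_)

-- Comparing two powers of one base leaves three outcomes, each a linear relation; so a pattern of
-- kinds becomes finitely many linear systems, and the multipliers in the `⊕`-sums are certificates
-- of infeasibility. Index 3 is where the factor 2 begins to reach the last term: `2 ≤ t₀` gives t_j
-- ≤ 2 t_i - 2 whenever j ≤ 2i. The term t₂ is within that factor only of t₃ and t₄, though within a
-- factor 3 of t₆; its kind is kept for patterns with two terms dominated by each base. The main
-- obstacle is the shapes 1 + 2^y and 3^x + 2: their large power lies outside the class of the
-- ordinary terms, so it can be exactly two or three times an ordinary dominating power, and this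
-- forced equality has to be exploited pattern by pattern. The modulus 24 makes these shapes
-- visible: the residues 1, 2, 4 each single out one power of 2, and the residue 1 singles out one
-- power of 3.

module Naturals where
  open N using (_+_; _*_)

  -- Combining linear inequalities

  infixl 6 _⊕_
  infixr 7 _⊗_
  infixl 7 _⊛_

  _⊕_ : ∀ {a b c d} → a ≤ b → c ≤ d → a + c ≤ b + d
  _⊕_ = +-mono-≤

  _⊗_ : ∀ {a b} c → a ≤ b → c * a ≤ c * b
  c ⊗ h = *-monoʳ-≤ c h

  _⊛_ : ∀ {a b} → a ≤ b → ∀ c → a * c ≤ b * c
  h ⊛ c = *-monoˡ-≤ c h

  -- A linear system is refuted by a nonnegative combination a ≤ b of its members
  -- with a = b + 1 + r identically.
  abstract
    absurd : ∀ {a b} r → a ≤ b → a ≡ suc (b + r) → ⊥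
    absurd r h refl = <⇒≱ (s≤s (m≤m+n _ r)) h

  squeeze : ∀ {a b} → ¬ b < a → ¬ a < b → a ≡ b
  squeeze b≮a a≮b = ≤-antisym (≮⇒≥ b≮a) (≮⇒≥ a≮b)

  -- Powers and their residues

  IsPower : ℕ → ℕ → Set
  IsPower b p = ∃ λ n → p ≡ b ^ n

  power-suc : ∀ {b p} → IsPower b p → IsPower b (b * p)
  power-suc (n , refl) = suc n , refl

  power-positive : ∀ {b p} .{{_ : NonZero b}} → IsPower b p → 1 ≤ p
  power-positive {b} (n , refl) = m^n>0 b n

  power-gap : ∀ b .{{_ : NonZero b}} {p q} → IsPower b p → IsPower b q →
              p ≡ q ⊎ b * p ≤ q ⊎ b * q ≤ p
  power-gap b (m , refl) (n , refl) with <-cmp m n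
  ... | tri< m<n _ _ = inj₂ (inj₁ (^-monoʳ-≤ b m<n))
  ... | tri≈ _ refl _ = inj₁ refl
  ... | tri> _ _ n<m = inj₂ (inj₂ (^-monoʳ-≤ b n<m))

  [m*n]%o≡[m*[n%o]]%o : ∀ m n o .{{_ : NonZero o}} → (m * n) % o ≡ (m * (n % o)) % o
  [m*n]%o≡[m*[n%o]]%o m n o = trans (%-distribˡ-* m n o)
    (sym (trans (%-distribˡ-* m (n % o) o) (cong (λ r → ((m % o) * r) % o) (m%n%n≡m%n n o))))

  -- Periodicity is replaced by closure: `R` is a set of residues that contains 1 and is stable
  -- under multiplication by `b`.
  power-residue : ∀ b m .{{_ : NonZero m}} (R : ℕ → Set) → R (1 % m) →
                  (∀ {r} → R r → R ((b * r) % m)) → ∀ {p} → IsPower b p → R (p % m)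
  power-residue b m R one step (zero , refl) = one
  power-residue b m R one step (suc n , refl) =
    subst R (sym ([m*n]%o≡[m*[n%o]]%o b (b ^ n) m)) (step (power-residue b m R one step (n , refl)))

  3^n%8 : ∀ {p} → IsPower 3 p → p % 8 ≡ 1 ⊎ p % 8 ≡ 3
  3^n%8 = power-residue 3 8 (λ r → r ≡ 1 ⊎ r ≡ 3) (inj₁ refl)
    λ { (inj₁ refl) → inj₂ refl ; (inj₂ refl) → inj₁ refl }

  2^n%3 : ∀ {q} → IsPower 2 q → q % 3 ≡ 1 ⊎ q % 3 ≡ 2
  2^n%3 = power-residue 2 3 (λ r → r ≡ 1 ⊎ r ≡ 2) (inj₁ refl)
    λ { (inj₁ refl) → inj₂ refl ; (inj₂ refl) → inj₁ refl }

  3∤2^n : ∀ {q} → IsPower 2 q → ¬ 3 ∣ q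
  3∤2^n {q} w 3∣q with q % 3 | 2^n%3 w | n∣m⇒m%n≡0 q 3 3∣q
  ... | _ | inj₁ refl | ()
  ... | _ | inj₂ refl | ()

  5∤2^n : ∀ {q} → IsPower 2 q → ¬ 5 ∣ q
  5∤2^n {q} w 5∣q with q % 5 | n∣m⇒m%n≡0 q 5 5∣q
    | power-residue 2 5 (λ r → r ≡ 1 ⊎ r ≡ 2 ⊎ r ≡ 4 ⊎ r ≡ 3) (inj₁ refl)
        (λ { (inj₁ refl) → inj₂ (inj₁ refl)
           ; (inj₂ (inj₁ refl)) → inj₂ (inj₂ (inj₁ refl))
           ; (inj₂ (inj₂ (inj₁ refl))) → inj₂ (inj₂ (inj₂ refl))
           ; (inj₂ (inj₂ (inj₂ refl))) → inj₁ refl }) w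
  ... | _ | () | inj₁ refl
  ... | _ | () | inj₂ (inj₁ refl)
  ... | _ | () | inj₂ (inj₂ (inj₁ refl))
  ... | _ | () | inj₂ (inj₂ (inj₂ refl))

  power-divides : ∀ {b k p} → 1 < b → IsPower b p → b ^ k ≤ p → b ^ k ∣ p
  power-divides {b} {k} 1<b (n , refl) b^k≤b^n =
    subst (λ m → b ^ k ∣ b ^ m) (m+[n∸m]≡n k≤n)
      (subst (b ^ k ∣_) (sym (^-distribˡ-+-* b k (n ∸ k))) (m∣m*n (b ^ (n ∸ k))))
    where
    k≤n : k ≤ n
    k≤n = ≮⇒≥ λ n<k → <⇒≱ (^-monoʳ-< b 1<b n<k) b^k≤b^n

  3-power-cases : ∀ {p} → IsPower 3 p → 3 ≤ p → p ≡ 3 ⊎ 9 ∣ p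
  3-power-cases (0 , refl) (s≤s ())
  3-power-cases (1 , refl) _ = inj₁ refl
  3-power-cases {p} w@(suc (suc n) , eq) _ =
    inj₂ (power-divides {3} {2} (s≤s (s≤s z≤n)) w
      (subst (9 ≤_) (sym eq) (^-monoʳ-≤ 3 {2} {suc (suc n)} (s≤s (s≤s z≤n)))))

  -- Modulo 16 a power of 2 that is one less than a power of 3 forces that power of 3
  -- to be a power of 81 ≡ 1 (mod 5).
  no-large-neighbours : ∀ {p q} → IsPower 3 p → IsPower 2 q → 27 ≤ p → p ≢ q + 1
  no-large-neighbours {q = q} w v 27≤p refl = 5∤2^n v (∣-trans (divides 16 refl) 80∣q)
    where
    16∣q : 16 ∣ q
    16∣q = power-divides {2} {4} (s≤s (s≤s z≤n)) v (≤-trans (m≤m+n 16 10) (+-cancelʳ-≤ 1 26 q 27≤p))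
    q+1%16 : (q + 1) % 80 % 16 ≡ 1
    q+1%16 = trans (m∣n⇒o%n%m≡o%m 16 80 (q + 1) (divides 5 refl))
      (trans (%-distribˡ-+ q 1 16) (cong (λ r → (r + 1) % 16) (n∣m⇒m%n≡0 q 16 16∣q)))
    q+1%80 : (q + 1) % 80 ≡ 1
    q+1%80 with (q + 1) % 80 | q+1%16
      | power-residue 3 80 (λ r → r ≡ 1 ⊎ r ≡ 3 ⊎ r ≡ 9 ⊎ r ≡ 27) (inj₁ refl)
          (λ { (inj₁ refl) → inj₂ (inj₁ refl)
             ; (inj₂ (inj₁ refl)) → inj₂ (inj₂ (inj₁ refl))
             ; (inj₂ (inj₂ (inj₁ refl))) → inj₂ (inj₂ (inj₂ refl))
             ; (inj₂ (inj₂ (inj₂ refl))) → inj₁ refl }) w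
    ... | _ | _ | inj₁ refl = refl
    ... | _ | () | inj₂ (inj₁ refl)
    ... | _ | () | inj₂ (inj₂ (inj₁ refl))
    ... | _ | () | inj₂ (inj₂ (inj₂ refl))
    80∣q : 80 ∣ q
    80∣q = divides ((q + 1) / 80) (+-cancelʳ-≡ 1 q _ (trans (m≡m%n+[m/n]*n (q + 1) 80)
      (trans (cong (_+ (q + 1) / 80 * 80) q+1%80) (+-comm 1 _))))

  widen : ∀ b .{{_ : NonZero b}} {p q} → IsPower b p → IsPower b q → b * p ≢ q →
          b * p ≤ q → b * (b * p) ≤ q
  widen b {p} w v bp≢q bp≤q with power-gap b (power-suc w) v
  ... | inj₁ bp≡q = ⊥-elim (bp≢q bp≡q)
  ... | inj₂ (inj₁ b²p≤q) = b²p≤q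
  ... | inj₂ (inj₂ bq≤bp) =
    ⊥-elim (bp≢q (≤-antisym bp≤q (≤-trans (*-cancelˡ-≤ b bq≤bp) (m≤n*m p b))))

  power-gap² : ∀ b .{{_ : NonZero b}} {p q} → IsPower b p → IsPower b q → b * p ≢ q → b * q ≢ p →
               p ≡ q ⊎ b * (b * p) ≤ q ⊎ b * (b * q) ≤ p
  power-gap² b w v bp≢q bq≢p with power-gap b w v
  ... | inj₁ p≡q = inj₁ p≡q
  ... | inj₂ (inj₁ bp≤q) = inj₂ (inj₁ (widen b w v bp≢q bp≤q))
  ... | inj₂ (inj₂ bq≤p) = inj₂ (inj₂ (widen b v w bq≢p bq≤p))

  -- Multiplication by 3 exchanges the residues 1 and 3 modulo 8, so a ratio of exactly 3 is
  -- impossible within a class.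
  power-gap₉ : ∀ {p p′} → IsPower 3 p → IsPower 3 p′ → p % 8 ≡ p′ % 8 →
               p ≡ p′ ⊎ 3 * (3 * p) ≤ p′ ⊎ 3 * (3 * p′) ≤ p
  power-gap₉ w v eq = power-gap² 3 w v (tripled w eq) (tripled v (sym eq))
    where
    tripled : ∀ {p p′} → IsPower 3 p → p % 8 ≡ p′ % 8 → 3 * p ≢ p′
    tripled {p} w eq refl with p % 8 | 3^n%8 w | trans eq ([m*n]%o≡[m*[n%o]]%o 3 p 8)
    ... | _ | inj₁ refl | ()
    ... | _ | inj₂ refl | ()

  power-gap₄ : ∀ {q q′} → IsPower 2 q → IsPower 2 q′ → q % 3 ≡ q′ % 3 →
               q ≡ q′ ⊎ 2 * (2 * q) ≤ q′ ⊎ 2 * (2 * q′) ≤ q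
  power-gap₄ w v eq = power-gap² 2 w v (doubled w eq) (doubled v (sym eq))
    where
    doubled : ∀ {q q′} → IsPower 2 q → q % 3 ≡ q′ % 3 → 2 * q ≢ q′
    doubled {q} w eq refl with q % 3 | 2^n%3 w | trans eq ([m*n]%o≡[m*[n%o]]%o 2 q 3)
    ... | _ | inj₁ refl | ()
    ... | _ | inj₂ refl | ()

  -- Terms within a bounded ratio, when 12 divides the difference

  -- The slack 4, like the 2 in `Close`, is what `2 ≤ t₀` leaves over: 3t_i - t_j = 2t₀ + (3i - j)d
  -- and 2t_i - t_j = t₀ + (2i - j)d. It absorbs the constants of the exceptional shapes.
  record Near (s t : ℕ) : Set where
    field
      increasing : s < t
      ratio₃     : t + 4 ≤ 3 * s

  record Close (s t : ℕ) : Set where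
    field
      increasing : s < t
      ratio₂     : t + 2 ≤ 2 * s

  -- ρ and σ are the residues of 3^x modulo 8 and of 2^y modulo 3 in an ordinary term.
  module Terms (ρ σ : ℕ) where

    record Main³ (p : ℕ) : Set where
      field
        power³   : IsPower 3 p
        class³   : p % 8 ≡ ρ
        3≤p      : 3 ≤ p

    record Main² (q : ℕ) : Set where
      field
        power²   : IsPower 2 q
        class²   : q % 3 ≡ σ
        4≤q      : 4 ≤ q

    record Main (_~_ : ℕ → ℕ → Set) (t p q : ℕ) : Set where
      field
        sum   : t ≡ p + q
        main³ : Main³ p
        main² : Main² q
        order : p ~ q

    -- With 4 ∣ q and q ≡ 1 (mod 3) the term is 5 modulo 12, which fixes `ρ` and `σ`; the class of
    -- `q` itself is then the wrong one.
    record Unit (t q : ℕ) : Set where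
      field
        ρ≡1   : ρ ≡ 1
        σ≡2   : σ ≡ 2
        power : IsPower 2 q
        other : q % 3 ≡ 1
        4≤    : 4 ≤ q
        sum   : t ≡ q + 1

    -- Adding 2 exchanges 1 and 3 modulo 4, which puts `p` in the class opposite to `ρ`.
    record Double (t p : ℕ) : Set where
      field
        σ≡2   : σ ≡ 2
        power : IsPower 3 p
        other : p % 8 ≢ ρ
        3≤    : 3 ≤ p
        sum   : t ≡ p + 2

    -- Ordinary terms dominated by the power of 2 (B) or of 3 (T), and the exceptional shapes
    -- 2^y + 1 (U) and 3^x + 2 (D).  Lemma names spell the kinds of the terms involved.
    data Kind (t : ℕ) : Set where
      B : ∀ {p q} → Main _<_ t p q → Kind t
      T : ∀ {p q} → Main _>_ t p q → Kind t
      U : ∀ {q} → Unit t q → Kind t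
      D : ∀ {p} → Double t p → Kind t

    open Main³
    open Main²
    open Main
    open Unit
    open Double
    open Close
    open Near

    -- Dominating powers of ordinary terms

    gap₉ : ∀ {p p′} → Main³ p → Main³ p′ → p ≡ p′ ⊎ 3 * (3 * p) ≤ p′ ⊎ 3 * (3 * p′) ≤ p
    gap₉ a b = power-gap₉ (power³ a) (power³ b) (trans (class³ a) (sym (class³ b)))

    gap₄ : ∀ {q q′} → Main² q → Main² q′ → q ≡ q′ ⊎ 2 * (2 * q) ≤ q′ ⊎ 2 * (2 * q′) ≤ q
    gap₄ a b = power-gap₄ (power² a) (power² b) (trans (class² a) (sym (class² b)))

    -- A term lies between its dominating power and twice that power, so a ratio of 4 between the
    -- powers forces a ratio above 2 between the terms, or reverses their order.
    same-q : ∀ {s t p q p′ q′} → Close s t → Main _<_ s p q → Main _<_ t p′ q′ → q ≡ q′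
    same-q {s} {t} {p} {q} {p′} {q′} c a b with gap₄ (main² a) (main² b)
    ... | inj₁ q≡q′ = q≡q′
    ... | inj₂ (inj₁ g) = ⊥-elim (absurd (3 + p′) (g ⊕ ratio₂ c ⊕ 2 ⊗ ≤-reflexive (sum a)
      ⊕ ≤-reflexive (sym (sum b)) ⊕ 2 ⊗ order a) (solve (s ∷ t ∷ p ∷ q ∷ p′ ∷ q′ ∷ [])))
    ... | inj₂ (inj₂ g) = ⊥-elim (absurd (3 + s + p) (g ⊕ 2 ⊗ increasing c
      ⊕ ≤-reflexive (sym (sum a)) ⊕ 2 ⊗ ≤-reflexive (sum b) ⊕ 2 ⊗ order b)
      (solve (s ∷ t ∷ p ∷ q ∷ p′ ∷ q′ ∷ [])))

    -- The wider gap 9 makes a ratio of 3 between the terms good enough here.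
    same-p : ∀ {s t p q p′ q′} → Near s t → Main _>_ s p q → Main _>_ t p′ q′ → p ≡ p′
    same-p {s} {t} {p} {q} {p′} {q′} c a b with gap₉ (main³ a) (main³ b)
    ... | inj₁ p≡p′ = p≡p′
    ... | inj₂ (inj₁ g) = ⊥-elim (absurd (20 + t + 2 * q′) (2 ⊗ g ⊕ 3 ⊗ ratio₃ c
      ⊕ 9 ⊗ ≤-reflexive (sum a) ⊕ 2 ⊗ ≤-reflexive (sym (sum b)) ⊕ 9 ⊗ order a)
      (solve (s ∷ t ∷ p ∷ q ∷ p′ ∷ q′ ∷ [])))
    ... | inj₂ (inj₂ g) = ⊥-elim (absurd (17 + 7 * s + 2 * q) (2 ⊗ g ⊕ 9 ⊗ increasing c
      ⊕ 2 ⊗ ≤-reflexive (sym (sum a)) ⊕ 9 ⊗ ≤-reflexive (sum b) ⊕ 9 ⊗ order b)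
      (solve (s ∷ t ∷ p ∷ q ∷ p′ ∷ q′ ∷ [])))

    9p≤p′ : ∀ {s t p p′ q} → s < t → Main _<_ s p q → Main _<_ t p′ q → 3 * (3 * p) ≤ p′
    9p≤p′ {s} {t} {p} {p′} {q} lt a b with gap₉ (main³ a) (main³ b)
    ... | inj₁ refl = ⊥-elim (absurd 0 (lt ⊕ ≤-reflexive (sym (sum a)) ⊕ ≤-reflexive (sum b))
      (solve (s ∷ t ∷ p ∷ q ∷ [])))
    ... | inj₂ (inj₁ g) = g
    ... | inj₂ (inj₂ g) = ⊥-elim (absurd (8 + 8 * p) (9 ⊗ lt ⊕ 9 ⊗ ≤-reflexive (sym (sum a))
      ⊕ 9 ⊗ ≤-reflexive (sum b) ⊕ g) (solve (s ∷ t ∷ p ∷ p′ ∷ q ∷ [])))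

    4q≤q′ : ∀ {s t p q q′} → s < t → Main _>_ s p q → Main _>_ t p q′ → 2 * (2 * q) ≤ q′
    4q≤q′ {s} {t} {p} {q} {q′} lt a b with gap₄ (main² a) (main² b)
    ... | inj₁ refl = ⊥-elim (absurd 0 (lt ⊕ ≤-reflexive (sym (sum a)) ⊕ ≤-reflexive (sum b))
      (solve (s ∷ t ∷ p ∷ q ∷ [])))
    ... | inj₂ (inj₁ g) = g
    ... | inj₂ (inj₂ g) = ⊥-elim (absurd (3 + 3 * q) (4 ⊗ lt ⊕ 4 ⊗ ≤-reflexive (sym (sum a))
      ⊕ 4 ⊗ ≤-reflexive (sum b) ⊕ g) (solve (s ∷ t ∷ p ∷ q ∷ q′ ∷ [])))

    -- Combinations of kinds at unspecified indices

    BBB′ : ∀ {s t u p p′ p″ q} → s < t → t < u → u + 3 * s ≤ 4 * t →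
           Main _<_ s p q → Main _<_ t p′ q → Main _<_ u p″ q → ⊥
    BBB′ {s} {t} {u} {p} {p′} {p″} {q} s<t t<u spread a b c =
      absurd (4 + 8 * p) (5 ⊗ s<t ⊕ spread ⊕ 8 ⊗ ≤-reflexive (sym (sum a))
        ⊕ 9 ⊗ ≤-reflexive (sum b) ⊕ ≤-reflexive (sym (sum c)) ⊕ 9p≤p′ t<u b c)
        (solve (s ∷ t ∷ u ∷ p ∷ p′ ∷ p″ ∷ q ∷ []))

    BBB : ∀ {s t u p p′ p″ q q′ q″} → Close s t → Close t u → u + 3 * s ≤ 4 * t →
          Main _<_ s p q → Main _<_ t p′ q′ → Main _<_ u p″ q″ → ⊥
    BBB st tu spread a b c with same-q st a b | same-q tu b c
    ... | refl | refl = BBB′ (increasing st) (increasing tu) spread a b c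

    -- The hypothesis on `u` says u - t ≤ 3(t - s). With a common power of 3 this reads q″ - q′ ≤
    -- 3(q′ - q), whereas q″ ≥ 4q′. The factor 3 is the largest that this argument allows; powers of
    -- 3 in place of `q` leave room to spare in `BBB′`.
    TTT : ∀ {s t u p p′ p″ q q′ q″} → Near s t → Near t u → u + 3 * s ≤ 4 * t →
          Main _>_ s p q → Main _>_ t p′ q′ → Main _>_ u p″ q″ → ⊥
    TTT {s} {t} {u} {p} {p′} {p″} {q} {q′} {q″} st tu spread a b c with same-p st a b
        | same-p tu b c
    ... | refl | refl =
      absurd 11 (spread ⊕ 3 ⊗ ≤-reflexive (sym (sum a)) ⊕ 4 ⊗ ≤-reflexive (sum b)
        ⊕ ≤-reflexive (sym (sum c)) ⊕ 4q≤q′ (increasing tu) b c ⊕ 3 ⊗ 4≤q (main² a))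
        (solve (s ∷ t ∷ u ∷ p ∷ q ∷ q′ ∷ q″ ∷ []))

    UU : ∀ {s t q q′} → Close s t → Unit s q → Unit t q′ → ⊥
    UU {s} {t} {q} {q′} c a b with power-gap 2 (power a) (power b)
    ... | inj₁ refl = absurd 0 (increasing c ⊕ ≤-reflexive (sym (sum a)) ⊕ ≤-reflexive (sum b))
      (solve (s ∷ t ∷ q ∷ []))
    ... | inj₂ (inj₁ g) = absurd 0 (ratio₂ c ⊕ 2 ⊗ ≤-reflexive (sum a)
      ⊕ ≤-reflexive (sym (sum b)) ⊕ g) (solve (s ∷ t ∷ q ∷ q′ ∷ []))
    ... | inj₂ (inj₂ g) = absurd s (2 ⊗ increasing c ⊕ ≤-reflexive (sym (sum a))
      ⊕ 2 ⊗ ≤-reflexive (sum b) ⊕ g) (solve (s ∷ t ∷ q ∷ q′ ∷ []))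

    DD : ∀ {s t p p′} → Close s t → Double s p → Double t p′ → ⊥
    DD {s} {t} {p} {p′} c a b with power-gap 3 (power a) (power b)
    ... | inj₁ refl = absurd 0 (increasing c ⊕ ≤-reflexive (sym (sum a)) ⊕ ≤-reflexive (sum b))
      (solve (s ∷ t ∷ p ∷ []))
    ... | inj₂ (inj₁ g) = absurd 2 (ratio₂ c ⊕ 2 ⊗ ≤-reflexive (sum a)
      ⊕ ≤-reflexive (sym (sum b)) ⊕ g ⊕ 3≤ a) (solve (s ∷ t ∷ p ∷ p′ ∷ []))
    ... | inj₂ (inj₂ g) = absurd (2 + 2 * p) (3 ⊗ increasing c ⊕ 3 ⊗ ≤-reflexive (sym (sum a))
      ⊕ 3 ⊗ ≤-reflexive (sum b) ⊕ g) (solve (s ∷ t ∷ p ∷ p′ ∷ []))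

    1≢2 : ∀ {n} → n ≡ 1 → n ≡ 2 → ⊥
    1≢2 refl ()

    UB : ∀ {s t q p′ q′} → Close s t → Unit s q → Main _<_ t p′ q′ → ⊥
    UB {s} {t} {q} {p′} {q′} c a b with power-gap 2 (power a) (power² (main² b))
    ... | inj₁ refl = 1≢2 (other a) (trans (class² (main² b)) (σ≡2 a))
    ... | inj₂ (inj₁ g) = absurd 2 (ratio₂ c ⊕ 2 ⊗ ≤-reflexive (sum a)
      ⊕ ≤-reflexive (sym (sum b)) ⊕ g ⊕ 3≤p (main³ b)) (solve (s ∷ t ∷ q ∷ p′ ∷ q′ ∷ []))
    ... | inj₂ (inj₂ g) = absurd 2 (increasing c ⊕ ≤-reflexive (sym (sum a))
      ⊕ ≤-reflexive (sum b) ⊕ g ⊕ order b) (solve (s ∷ t ∷ q ∷ p′ ∷ q′ ∷ []))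

    DT : ∀ {s t p p′ q′} → Near s t → Double s p → Main _>_ t p′ q′ → ⊥
    DT {s} {t} {p} {p′} {q′} c a b with power-gap 3 (power a) (power³ (main³ b))
    ... | inj₁ refl = other a (class³ (main³ b))
    ... | inj₂ (inj₁ g) = absurd 1 (ratio₃ c ⊕ 3 ⊗ ≤-reflexive (sum a)
      ⊕ ≤-reflexive (sym (sum b)) ⊕ g ⊕ 4≤q (main² b)) (solve (s ∷ t ∷ p ∷ p′ ∷ q′ ∷ []))
    ... | inj₂ (inj₂ g) = absurd (9 + s) (3 ⊗ increasing c ⊕ 2 ⊗ ≤-reflexive (sym (sum a))
      ⊕ 3 ⊗ ≤-reflexive (sum b) ⊕ 2 ⊗ g ⊕ 3 ⊗ order b) (solve (s ∷ t ∷ p ∷ p′ ∷ q′ ∷ []))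

    -- The classes modulo 3 differ, so equality is excluded; closeness excludes descent and a factor
    -- of 4, and exact doubling remains.
    B-U : ∀ {s t p q q′} → Close s t → Main _<_ s p q → Unit t q′ → 2 * q ≡ q′
    B-U {s} {t} {p} {q} {q′} c a b with power-gap 2 (power² (main² a)) (power b)
    ... | inj₁ refl = ⊥-elim (1≢2 (other b) (trans (class² (main² a)) (σ≡2 b)))
    ... | inj₂ (inj₂ g) = ⊥-elim (absurd (3 + p) (g ⊕ increasing c ⊕ ≤-reflexive (sym (sum a))
      ⊕ ≤-reflexive (sum b) ⊕ 4≤ b) (solve (s ∷ t ∷ p ∷ q ∷ q′ ∷ [])))
    ... | inj₂ (inj₁ g) with power-gap 2 (power-suc (power² (main² a))) (power b)
    ...   | inj₁ eq = eq
    ...   | inj₂ (inj₁ g′) = ⊥-elim (absurd 4 (g′ ⊕ ratio₂ c ⊕ 2 ⊗ ≤-reflexive (sum a)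
      ⊕ ≤-reflexive (sym (sum b)) ⊕ 2 ⊗ order a) (solve (s ∷ t ∷ p ∷ q ∷ q′ ∷ [])))
    ...   | inj₂ (inj₂ g′) = ⊥-elim (absurd 7 (g′ ⊕ 2 ⊗ g ⊕ 2 ⊗ 4≤q (main² a))
      (solve (q ∷ q′ ∷ [])))

    -- The analogue of `B-U` for base 3: opposite classes modulo 8 exclude equality, and closeness
    -- leaves only the ratio 3.
    T-D : ∀ {s t p q p′} → Close s t → Main _>_ s p q → Double t p′ → 3 * p ≡ p′
    T-D {s} {t} {p} {q} {p′} c a b with power-gap 3 (power³ (main³ a)) (power b)
    ... | inj₁ refl = ⊥-elim (other b (class³ (main³ a)))
    ... | inj₂ (inj₂ g) = ⊥-elim (absurd (4 + q) (g ⊕ increasing c ⊕ ≤-reflexive (sym (sum a))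
      ⊕ ≤-reflexive (sum b) ⊕ 2 ⊗ 3≤ b) (solve (s ∷ t ∷ p ∷ q ∷ p′ ∷ [])))
    ... | inj₂ (inj₁ g) with power-gap 3 (power-suc (power³ (main³ a))) (power b)
    ...   | inj₁ eq = eq
    ...   | inj₂ (inj₁ g′) = ⊥-elim (absurd (16 + 5 * s) (2 ⊗ g′ ⊕ 2 ⊗ ratio₂ c
      ⊕ 9 ⊗ ≤-reflexive (sum a) ⊕ 2 ⊗ ≤-reflexive (sym (sum b)) ⊕ 9 ⊗ order a)
      (solve (s ∷ t ∷ p ∷ q ∷ p′ ∷ [])))
    ...   | inj₂ (inj₂ g′) = ⊥-elim (absurd 17 (g′ ⊕ 3 ⊗ g ⊕ 6 ⊗ 3≤p (main³ a))
      (solve (p ∷ p′ ∷ [])))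

    -- By `T-D`, 2t = 6p + 4, while q < p gives 3s + 6 ≤ 6p + 3.
    TD : ∀ {s t p q p′} → Close s t → 2 * t ≤ 3 * s + 6 → Main _>_ s p q → Double t p′ → ⊥
    TD {s} {t} {p} {q} c h a b with T-D c a b
    ... | refl = absurd 0 (h ⊕ 3 ⊗ ≤-reflexive (sum a) ⊕ 2 ⊗ ≤-reflexive (sym (sum b))
      ⊕ 3 ⊗ order a) (solve (s ∷ t ∷ p ∷ q ∷ []))

    -- The weights make the common power cancel: u = 2q + 1 contributes 8q to the left side and `t`
    -- contributes q, against 9q from 9s. What remains contradicts 9p ≤ p′.
    BBU : ∀ {s t u p p′ q q′ q″} → Close s t → Close t u → 4 * u + t ≤ 9 * s →
          Main _<_ s p q → Main _<_ t p′ q′ → Unit u q″ → ⊥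
    BBU {s} {t} {u} {p} {p′} {q} st tu h a b c with same-q st a b | B-U tu b c
    ... | refl | refl = absurd 3 (h ⊕ 9 ⊗ ≤-reflexive (sum a) ⊕ ≤-reflexive (sym (sum b))
      ⊕ 4 ⊗ ≤-reflexive (sym (sum c)) ⊕ 9p≤p′ (increasing st) a b)
      (solve (s ∷ t ∷ u ∷ p ∷ p′ ∷ q ∷ []))

    -- After i = 2q + 1 and p = p′, one hypothesis serves each case. If 9a ≤ p, then 18k ≤ 2p + 18q,
    -- against the bound on 9i + 2m. If 9p ≤ a, then k > 18p while m < 2p, against k ≤ 2m. If a = p,
    -- the orders f < p and a < q leave only 4f ≤ q, against k + 2m ≤ 3n.
    BUTT : ∀ {k i m n a q q″ p p′ e f} → Close k i → Near m n → k + 2 * m ≤ 3 * n →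
           9 * i + 2 * m ≤ 18 * k → k ≤ 2 * m →
           Main _<_ k a q → Unit i q″ → Main _>_ m p e → Main _>_ n p′ f → ⊥
    BUTT {k} {i} {m} {n} {a} {q} {q″} {p} {p′} {e} {f} ki mn h₁ h₂ h₃ b u t t′
      with B-U ki b u | same-p mn t t′
    ... | refl | refl with gap₉ (main³ b) (main³ t)
    ...   | inj₂ (inj₁ g) = absurd (8 + 2 * e) (2 ⊗ g ⊕ 18 ⊗ ≤-reflexive (sum b)
      ⊕ 9 ⊗ ≤-reflexive (sym (sum u)) ⊕ 2 ⊗ ≤-reflexive (sym (sum t)) ⊕ h₂)
      (solve (k ∷ i ∷ m ∷ a ∷ q ∷ p ∷ e ∷ []))
    ...   | inj₂ (inj₂ g) = absurd (17 + 5 * k + 4 * q) (4 ⊗ g ⊕ 4 ⊗ ≤-reflexive (sym (sum b))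
      ⊕ 18 ⊗ ≤-reflexive (sum t) ⊕ 18 ⊗ order t ⊕ 9 ⊗ h₃) (solve (k ∷ m ∷ a ∷ q ∷ p ∷ e ∷ []))
    ...   | inj₁ refl with gap₄ (main² t′) (main² b)
    ...     | inj₁ refl = absurd 1 (order b ⊕ order t′) (solve (a ∷ q ∷ []))
    ...     | inj₂ (inj₂ g) = absurd (4 + 3 * a) (4 ⊗ order b ⊕ order t′ ⊕ g)
      (solve (a ∷ q ∷ f ∷ []))
    ...     | inj₂ (inj₁ g) = absurd (3 + 2 * e) (≤-reflexive (sym (sum b))
      ⊕ 2 ⊗ ≤-reflexive (sym (sum t)) ⊕ 3 ⊗ ≤-reflexive (sum t′) ⊕ g ⊕ h₁ ⊕ 4≤q (main² t′))
      (solve (k ∷ m ∷ n ∷ a ∷ q ∷ e ∷ f ∷ []))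

    -- Two terms of each kind B and T, the B's coming early enough: the kind of t₂ decides.
    settle : ∀ {r s t m n p p′ q q′ x x′ e e′} → Close r s → Close s t → t + 3 * r ≤ 4 * s →
             Near r m → Near m n → n + 3 * r ≤ 4 * m →
             Main _<_ s p q → Main _<_ t p′ q′ → Main _>_ m x e → Main _>_ n x′ e′ → Kind r → ⊥
    settle rs st h rm mn h′ s t m n (B r) = BBB rs st h r s t
    settle rs st h rm mn h′ s t m n (T r) = TTT rm mn h′ r m n
    settle rs st h rm mn h′ s t m n (U r) = UB rs r s
    settle rs st h rm mn h′ s t m n (D r) = DT rm r m

    -- A second comparison, now with 4q, sharpens "at least 4 times" to "exactly 4 times or at least
    -- 16 times".
    quadruple : ∀ {q} → Main² q → Main² (2 * (2 * q))
    quadruple {q} a = record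
      { power² = power-suc (power-suc (power² a))
      ; class² = trans residue (class² a)
      ; 4≤q = ≤-trans (4≤q a) (≤-trans (m≤n*m q 2) (m≤n*m (2 * q) 2))
      }
      where
      fixed : ∀ {r} → r ≡ 1 ⊎ r ≡ 2 → (2 * ((2 * r) % 3)) % 3 ≡ r
      fixed (inj₁ refl) = refl
      fixed (inj₂ refl) = refl
      residue : (2 * (2 * q)) % 3 ≡ q % 3
      residue = trans ([m*n]%o≡[m*[n%o]]%o 2 (2 * q) 3)
        (trans (cong (λ r → (2 * r) % 3) ([m*n]%o≡[m*[n%o]]%o 2 q 3)) (fixed (2^n%3 (power² a))))

    -- Doubling brings the power of an exceptional term into the ordinary class, where `gap₄`
    -- applies.
    double : ∀ {t q} → Unit t q → Main² (2 * q)
    double {q = q} a = record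
      { power² = power-suc (power a)
      ; class² = trans ([m*n]%o≡[m*[n%o]]%o 2 q 3)
          (trans (cong (λ r → (2 * r) % 3) (other a)) (sym (σ≡2 a)))
      ; 4≤q = ≤-trans (4≤ a) (m≤n*m q 2)
      }

    -- The only power to exclude is 3, which has residue 3 modulo 8.
    9∣main³ : ∀ {p} → ρ ≡ 1 → Main³ p → 9 ∣ p
    9∣main³ ρ≡1 a with 3-power-cases (power³ a) (3≤p a)
    ... | inj₂ 9∣p = 9∣p
    ... | inj₁ refl with trans (class³ a) ρ≡1
    ...   | ()

    -- The only power to exclude is 4, which has residue 1 modulo 3.
    8∣main² : ∀ {q} → σ ≡ 2 → Main² q → 8 ∣ q
    8∣main² σ≡2 a with power² a | trans (class² a) σ≡2 | 4≤q a
    ... | 0 , refl | _ | s≤s ()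
    ... | 1 , refl | _ | s≤s (s≤s ())
    ... | 2 , refl | () | _
    ... | suc (suc (suc n)) , eq | _ | _ = power-divides {2} {3} (s≤s (s≤s z≤n)) (power² a)
      (subst (8 ≤_) (sym eq) (^-monoʳ-≤ 2 {3} {suc (suc (suc n))} (s≤s (s≤s (s≤s z≤n)))))

    -- Patterns at fixed indices of the progression

    module Leaves (t₀ d : ℕ) (2≤t₀ : 2 ≤ t₀) (1≤d : 1 ≤ d) (4∣d : 4 ∣ d) where

      term : ℕ → ℕ
      term i = t₀ + i * d

      t<t : ∀ i j → {True (i N.<? j)} → term i < term j
      t<t i j {i<j} = +-monoʳ-< t₀ (*-monoˡ-< d {{N.>-nonZero 1≤d}} (toWitness i<j))

      close : ∀ i j → {True (i N.<? j)} → {True (j N.≤? 2 * i)} → Close (term i) (term j)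
      close i j {i<j} {j≤2i} = record
        { increasing = t<t i j {i<j}
        ; ratio₂ = ≮⇒≥ (bound (toWitness j≤2i))
        }
        where
        bound : j ≤ 2 * i → ¬ 2 * (t₀ + i * d) < t₀ + j * d + 2
        bound h lt = absurd 0 (lt ⊕ 2≤t₀ ⊕ h ⊛ d) (solve (t₀ ∷ d ∷ i ∷ j ∷ []))

      near : ∀ i j → {True (i N.<? j)} → {True (j N.≤? 3 * i)} → Near (term i) (term j)
      near i j {i<j} {j≤3i} = record
        { increasing = t<t i j {i<j}
        ; ratio₃ = ≮⇒≥ (bound (toWitness j≤3i))
        }
        where
        bound : j ≤ 3 * i → ¬ 3 * (t₀ + i * d) < t₀ + j * d + 4
        bound h lt = absurd 0 (lt ⊕ 2 ⊗ 2≤t₀ ⊕ h ⊛ d) (solve (t₀ ∷ d ∷ i ∷ j ∷ []))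

      spread : ∀ i j k → {True (k + 3 * i N.≤? 4 * j)} → term k + 3 * term i ≤ 4 * term j
      spread i j k {h} = ≮⇒≥ (bound (toWitness h))
        where
        bound : k + 3 * i ≤ 4 * j → ¬ 4 * (t₀ + j * d) < t₀ + k * d + 3 * (t₀ + i * d)
        bound h lt = absurd 0 (lt ⊕ h ⊛ d) (solve (t₀ ∷ d ∷ i ∷ j ∷ k ∷ []))

      -- The difference 2d is both t₅ - t₃ = 2p + 2 - e, which exceeds p, and t₆ - t₄ = b′ - a′.
      -- This excludes b′ ≤ p, and 9p ≤ b′ would make t₆ too large.
      TBDB : ∀ {p e a′ q b′ q′ p′} → Main _>_ (t₀ + 3 * d) p e → Main _<_ (t₀ + 4 * d) a′ q →
             Double (t₀ + 5 * d) p′ → Main _<_ (t₀ + 6 * d) b′ q′ → ⊥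
      TBDB {p} {e} {a′} {q} {b′} t a x b with same-q (close 4 6) a b | T-D (close 3 5) t x
      ... | refl | refl with gap₉ (main³ b) (main³ t)
      ...   | inj₁ refl = absurd (2 + a′) (≤-reflexive (sum t) ⊕ ≤-reflexive (sym (sum x))
        ⊕ order t ⊕ ≤-reflexive (sym (sum a)) ⊕ ≤-reflexive (sum b))
        (solve (t₀ ∷ d ∷ p ∷ e ∷ a′ ∷ q ∷ []))
      ...   | inj₂ (inj₁ g) = absurd (114 + 16 * t₀ + 9 * a′) (49 ⊗ ≤-reflexive (sum t)
        ⊕ 33 ⊗ ≤-reflexive (sym (sum x)) ⊕ 49 ⊗ order t ⊕ 9 ⊗ ≤-reflexive (sym (sum a))
        ⊕ 9 ⊗ ≤-reflexive (sum b) ⊕ g) (solve (t₀ ∷ d ∷ p ∷ e ∷ a′ ∷ q ∷ b′ ∷ []))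
      ...   | inj₂ (inj₂ g) = absurd (6 + t₀ + 5 * e + q) (2 ⊗ ≤-reflexive (sum t) ⊕ 7 ⊗ order t
        ⊕ ≤-reflexive (sym (sum b)) ⊕ g) (solve (t₀ ∷ d ∷ p ∷ e ∷ q ∷ b′ ∷ []))

      TBBD : ∀ {p e a′ q b′ q′ p′} → Main _>_ (t₀ + 3 * d) p e → Main _<_ (t₀ + 4 * d) a′ q →
             Main _<_ (t₀ + 5 * d) b′ q′ → Double (t₀ + 6 * d) p′ → ⊥
      TBBD {p} {e} {a′} {q} {b′} t a b x with same-q (close 4 5) a b | T-D (close 3 6) t x
      ... | refl | refl with gap₉ (main³ b) (main³ t) | 9p≤p′ (t<t 4 5) a b
      ...   | inj₁ refl | h = absurd (3 + 4 * t₀ + 3 * d) (4 ⊗ ≤-reflexive (sum t) ⊕ 4 ⊗ order t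
        ⊕ 9 ⊗ ≤-reflexive (sum a) ⊕ 9 ⊗ ≤-reflexive (sym (sum b)) ⊕ h)
        (solve (t₀ ∷ d ∷ p ∷ e ∷ a′ ∷ q ∷ []))
      ...   | inj₂ (inj₁ g) | _ = absurd (16 + 2 * t₀ + 9 * a′) (7 ⊗ ≤-reflexive (sum t)
        ⊕ 5 ⊗ ≤-reflexive (sym (sum x)) ⊕ 7 ⊗ order t ⊕ 9 ⊗ ≤-reflexive (sym (sum a))
        ⊕ 9 ⊗ ≤-reflexive (sum b) ⊕ g) (solve (t₀ ∷ d ∷ p ∷ e ∷ a′ ∷ q ∷ b′ ∷ []))
      ...   | inj₂ (inj₂ g) | _ = absurd (6 + 2 * t₀ + q) (3 ⊗ ≤-reflexive (sum x) ⊕ 13 ⊗ 1≤d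
        ⊕ ≤-reflexive (sym (sum b)) ⊕ g) (solve (t₀ ∷ d ∷ p ∷ q ∷ b′ ∷ []))

      8∤2p+2 : ∀ {p} → p % 8 ≡ 1 → ¬ 8 ∣ 2 * p + 2
      8∤2p+2 {p} p%8≡1 8∣ with trans (sym (n∣m⇒m%n≡0 (2 * p + 2) 8 8∣)) remainder
        where
        2p%8 : (2 * p) % 8 ≡ 2
        2p%8 = trans ([m*n]%o≡[m*[n%o]]%o 2 p 8) (cong (λ r → (2 * r) % 8) p%8≡1)
        remainder : (2 * p + 2) % 8 ≡ 4
        remainder = trans (%-distribˡ-+ (2 * p) 2 8) (cong (λ r → (r + 2) % 8) 2p%8)
      ... | ()

      -- Sizes alone do not decide. The identity 2d + e = 2p + 2 from t₃ and t₅ fails modulo 8: 4 ∣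
      -- d and 8 ∣ e, but p ≡ 1.
      TBDU : ∀ {p e a′ q p′ q′} → Main _>_ (t₀ + 3 * d) p e → Main _<_ (t₀ + 4 * d) a′ q →
             Double (t₀ + 5 * d) p′ → Unit (t₀ + 6 * d) q′ → ⊥
      TBDU {p} {e} t a x u with T-D (close 3 5) t x
      ... | refl = 8∤2p+2 {p} (trans (class³ (main³ t)) (ρ≡1 u))
        (subst (8 ∣_) 2d+e≡2p+2 (∣m∣n⇒∣m+n (*-monoʳ-∣ 2 4∣d) (8∣main² (σ≡2 u) (main² t))))
        where
        2d+e≡2p+2 : 2 * d + e ≡ 2 * p + 2
        2d+e≡2p+2 = squeeze
          (λ lt → absurd 0 (lt ⊕ ≤-reflexive (sym (sum t)) ⊕ ≤-reflexive (sum x))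
            (solve (t₀ ∷ d ∷ p ∷ e ∷ [])))
          (λ lt → absurd 0 (lt ⊕ ≤-reflexive (sum t) ⊕ ≤-reflexive (sym (sum x)))
            (solve (t₀ ∷ d ∷ p ∷ e ∷ [])))

      -- Here the coefficient of `d` is odd, so 8 ∣ d is needed. It comes from t₅ - t₄ = q + 1 - a′
      -- with q ≡ 0 and a′ ≡ 1 modulo 8.
      TBUD : ∀ {p e a′ q p′ q′} → Main _>_ (t₀ + 3 * d) p e → Main _<_ (t₀ + 4 * d) a′ q →
             Unit (t₀ + 5 * d) q′ → Double (t₀ + 6 * d) p′ → ⊥
      TBUD {p} {e} {a′} {q} t a u x with B-U (close 4 5) a u | T-D (close 3 6) t x
      ... | refl | refl = 8∤2p+2 {p} (trans (class³ (main³ t)) (ρ≡1 u))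
        (subst (8 ∣_) 3d+e≡2p+2 (∣m∣n⇒∣m+n (∣n⇒∣m*n 3 8∣d) (8∣main² (σ≡2 u) (main² t))))
        where
        3d+e≡2p+2 : 3 * d + e ≡ 2 * p + 2
        3d+e≡2p+2 = squeeze
          (λ lt → absurd 0 (lt ⊕ ≤-reflexive (sym (sum t)) ⊕ ≤-reflexive (sum x))
            (solve (t₀ ∷ d ∷ p ∷ e ∷ [])))
          (λ lt → absurd 0 (lt ⊕ ≤-reflexive (sum t) ⊕ ≤-reflexive (sym (sum x)))
            (solve (t₀ ∷ d ∷ p ∷ e ∷ [])))
        a′≡1+8k : a′ ≡ 1 + a′ / 8 * 8
        a′≡1+8k =
          trans (m≡m%n+[m/n]*n a′ 8) (cong (_+ a′ / 8 * 8) (trans (class³ (main³ a)) (ρ≡1 u)))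
        8k+d≡q : ∀ {k} → a′ ≡ 1 + k * 8 → k * 8 + d ≡ q
        8k+d≡q {k} eq = squeeze
          (λ lt → absurd 0 (lt ⊕ ≤-reflexive (sym eq) ⊕ ≤-reflexive (sym (sum a))
            ⊕ ≤-reflexive (sum u)) (solve (t₀ ∷ d ∷ a′ ∷ q ∷ k ∷ [])))
          (λ lt → absurd 0 (lt ⊕ ≤-reflexive eq ⊕ ≤-reflexive (sum a)
            ⊕ ≤-reflexive (sym (sum u))) (solve (t₀ ∷ d ∷ a′ ∷ q ∷ k ∷ [])))
        8∣d : 8 ∣ d
        8∣d =
          ∣m+n∣m⇒∣n (subst (8 ∣_) (sym (8k+d≡q {a′ / 8} a′≡1+8k)) (8∣main² (σ≡2 u) (main² a)))
            (n∣m*n (a′ / 8))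

      -- `BBU` just fails at the indices 3, 4, 6, since 4·6 + 4 > 9·3; the kind of t₅ has to help.
      BBTU : ∀ {a′ q b′ q′ p e q″} → Main _<_ (t₀ + 3 * d) a′ q → Main _<_ (t₀ + 4 * d) b′ q′ →
             Main _>_ (t₀ + 5 * d) p e → Unit (t₀ + 6 * d) q″ → ⊥
      BBTU {a′} {q} {b′} {_} {p} {e} a b t u with same-q (close 3 4) a b | B-U (close 4 6) b u
      ... | refl | refl with gap₉ (main³ b) (main³ t)
      ...   | inj₁ refl = absurd 2 (2 ⊗ ≤-reflexive (sym (sum b)) ⊕ ≤-reflexive (sum t)
        ⊕ ≤-reflexive (sum u) ⊕ order t ⊕ 3 ⊗ 1≤d) (solve (t₀ ∷ d ∷ q ∷ p ∷ e ∷ []))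
      ...   | inj₂ (inj₁ g) = absurd (30 + 17 * t₀ + 8 * q + 6 * e) (31 ⊗ ≤-reflexive (sym (sum u))
        ⊕ 54 ⊗ ≤-reflexive (sum b) ⊕ 6 ⊗ ≤-reflexive (sym (sum t)) ⊕ 6 ⊗ g)
        (solve (t₀ ∷ d ∷ q ∷ b′ ∷ p ∷ e ∷ []))
      ...   | inj₂ (inj₂ g) = absurd (8 + 7 * t₀ + 37 * d + 2 * q) (9 ⊗ order t
        ⊕ 2 ⊗ ≤-reflexive (sym (sum b)) ⊕ 9 ⊗ ≤-reflexive (sum t) ⊕ 2 ⊗ g)
        (solve (t₀ ∷ d ∷ q ∷ b′ ∷ p ∷ e ∷ []))

      BTBU : ∀ {a′ q b′ q′ p e q″} → Main _<_ (t₀ + 3 * d) a′ q → Main _>_ (t₀ + 4 * d) p e →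
             Main _<_ (t₀ + 5 * d) b′ q′ → Unit (t₀ + 6 * d) q″ → ⊥
      BTBU {a′} {q} {b′} {_} {p} {e} a t b u with same-q (close 3 5) a b | B-U (close 5 6) b u
      ... | refl | refl with gap₉ (main³ b) (main³ t) | 9p≤p′ (t<t 3 5) a b
      -- With b′ = p, the relation t₄ + t₆ = 2t₅ becomes p = e + 1. The solution 9 = 8 + 1 is
      -- avoided because p ≥ 9a′ ≥ 27.
      ...   | inj₁ refl | h = no-large-neighbours (power³ (main³ b)) (power² (main² t))
                (≤-trans (3 ⊗ 3 ⊗ 3≤p (main³ a)) h)
                (squeeze
                  (λ lt → absurd 0 (lt ⊕ ≤-reflexive (sum t) ⊕ 2 ⊗ ≤-reflexive (sym (sum b))
                    ⊕ ≤-reflexive (sum u)) (solve (t₀ ∷ d ∷ q ∷ p ∷ e ∷ [])))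
                  (λ lt → absurd 0 (lt ⊕ ≤-reflexive (sym (sum t)) ⊕ 2 ⊗ ≤-reflexive (sum b)
                    ⊕ ≤-reflexive (sym (sum u))) (solve (t₀ ∷ d ∷ q ∷ p ∷ e ∷ []))))
      ...   | inj₂ (inj₁ g) | _ = absurd (40 + 7 * t₀ + 28 * q + 6 * e) (6 ⊗ g
        ⊕ 6 ⊗ ≤-reflexive (sym (sum t)) ⊕ 54 ⊗ ≤-reflexive (sum b)
        ⊕ 41 ⊗ ≤-reflexive (sym (sum u))) (solve (t₀ ∷ d ∷ q ∷ b′ ∷ p ∷ e ∷ []))
      ...   | inj₂ (inj₂ g) | _ = absurd (8 + 7 * t₀ + 26 * d + 2 * q) (2 ⊗ g ⊕ 9 ⊗ order t
        ⊕ 9 ⊗ ≤-reflexive (sum t) ⊕ 2 ⊗ ≤-reflexive (sym (sum b)))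
        (solve (t₀ ∷ d ∷ q ∷ b′ ∷ p ∷ e ∷ []))

      BBDU : ∀ {a′ q b′ q′ p q″} → Main _<_ (t₀ + 3 * d) a′ q → Main _<_ (t₀ + 4 * d) b′ q′ →
             Double (t₀ + 5 * d) p → Unit (t₀ + 6 * d) q″ → ⊥
      BBDU {a′} {q} {b′} {_} {p} a b x u with same-q (close 3 4) a b | B-U (close 4 6) b u
      ... | refl | refl with 3-power-cases (power x) (3≤ x)
      ...   | inj₁ refl = absurd 1 (≤-reflexive (sum x) ⊕ 2≤t₀ ⊕ 5 ⊗ 1≤d) (solve (t₀ ∷ d ∷ []))
      ...   | inj₂ 9∣p = from-no (9 ∣? 3) (∣m+n∣m⇒∣n
                (subst (9 ∣_) (sym identity) (∣n⇒∣m*n 5 (9∣main³ (ρ≡1 u) (main³ b))))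
                (∣m∣n⇒∣m+n 9∣p (∣n⇒∣m*n 3 (9∣main³ (ρ≡1 u) (main³ a)))))
        where
        -- From 5t₄ = 3t₃ + t₅ + t₆, a relation that eliminates `t₀`, `d` and the common power `q`.
        identity : p + 3 * a′ + 3 ≡ 5 * b′
        identity = squeeze
          (λ lt → absurd 0 (lt ⊕ 3 ⊗ ≤-reflexive (sym (sum a)) ⊕ 5 ⊗ ≤-reflexive (sum b)
            ⊕ ≤-reflexive (sym (sum x)) ⊕ ≤-reflexive (sym (sum u)))
            (solve (t₀ ∷ d ∷ a′ ∷ q ∷ b′ ∷ p ∷ [])))
          (λ lt → absurd 0 (lt ⊕ 3 ⊗ ≤-reflexive (sum a) ⊕ 5 ⊗ ≤-reflexive (sym (sum b))
            ⊕ ≤-reflexive (sum x) ⊕ ≤-reflexive (sum u)) (solve (t₀ ∷ d ∷ a′ ∷ q ∷ b′ ∷ p ∷ [])))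

      BDBU : ∀ {a′ q b′ q′ p q″} → Main _<_ (t₀ + 3 * d) a′ q → Double (t₀ + 4 * d) p →
             Main _<_ (t₀ + 5 * d) b′ q′ → Unit (t₀ + 6 * d) q″ → ⊥
      BDBU {a′} {q} {b′} {_} {p} a x b u with same-q (close 3 5) a b | B-U (close 5 6) b u
      ... | refl | refl with 3-power-cases (power x) (3≤ x)
      ...   | inj₁ refl = absurd 0 (≤-reflexive (sum x) ⊕ 2≤t₀ ⊕ 4 ⊗ 1≤d) (solve (t₀ ∷ d ∷ []))
      ...   | inj₂ 9∣p = from-no (9 ∣? 3) (∣m+n∣m⇒∣n
                (subst (9 ∣_) (sym identity) (∣n⇒∣m*n 2 (9∣main³ (ρ≡1 u) (main³ b)))) 9∣p)
        where
        -- From 2t₅ = t₄ + t₆, where `q` cancels.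
        identity : p + 3 ≡ 2 * b′
        identity = squeeze
          (λ lt → absurd 0 (lt ⊕ 2 ⊗ ≤-reflexive (sum b) ⊕ ≤-reflexive (sym (sum x))
            ⊕ ≤-reflexive (sym (sum u))) (solve (t₀ ∷ d ∷ q ∷ b′ ∷ p ∷ [])))
          (λ lt → absurd 0 (lt ⊕ 2 ⊗ ≤-reflexive (sym (sum b)) ⊕ ≤-reflexive (sum x)
            ⊕ ≤-reflexive (sum u)) (solve (t₀ ∷ d ∷ q ∷ b′ ∷ p ∷ [])))

      BTTU : ∀ {a′ q p e p′ f q″} → Main _<_ (t₀ + 3 * d) a′ q → Main _>_ (t₀ + 4 * d) p e →
             Main _>_ (t₀ + 5 * d) p′ f → Unit (t₀ + 6 * d) q″ → ⊥
      BTTU {a′} {q} {p} {e} {_} {f} a t t′ u with B-U (close 3 6) a u | same-p (near 4 5) t t′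
      ... | refl | refl with 4q≤q′ (t<t 4 5) t t′ | gap₄ (main² a) (main² t′)
      -- Here d = f - e is at least 3q/4, too large for t₆ = 2q + 1.
      ...   | 4e≤f | inj₁ refl = absurd (2 + 10 * d) (8 ⊗ ≤-reflexive (sum t)
        ⊕ 8 ⊗ ≤-reflexive (sym (sum t′)) ⊕ 3 ⊗ ≤-reflexive (sum u) ⊕ 2 ⊗ 4e≤f ⊕ 3 ⊗ 2≤t₀)
        (solve (t₀ ∷ d ∷ q ∷ e ∷ p ∷ []))
      ...   | 4e≤f | inj₂ (inj₁ g) = absurd (4 + t₀ + p) (≤-reflexive (sym (sum t′))
        ⊕ 2 ⊗ ≤-reflexive (sum u) ⊕ 7 ⊗ 1≤d ⊕ g) (solve (t₀ ∷ d ∷ q ∷ p ∷ f ∷ []))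
      ...   | 4e≤f | inj₂ (inj₂ g) with gap₉ (main³ a) (main³ t)
      ...     | inj₁ refl = absurd (6 + 3 * t₀ + 17 * d) (5 ⊗ ≤-reflexive (sym (sum a))
        ⊕ 8 ⊗ ≤-reflexive (sum t) ⊕ 2 ⊗ order t′ ⊕ 5 ⊗ order a ⊕ 2 ⊗ 4e≤f)
        (solve (t₀ ∷ d ∷ a′ ∷ q ∷ e ∷ f ∷ []))
      ...     | inj₂ (inj₁ h) = absurd (12 + 3 * t₀ + 34 * e) (18 ⊗ ≤-reflexive (sum a)
        ⊕ 34 ⊗ ≤-reflexive (sym (sum t)) ⊕ 32 ⊗ ≤-reflexive (sum t′)
        ⊕ 13 ⊗ ≤-reflexive (sym (sum u)) ⊕ 8 ⊗ g ⊕ 2 ⊗ h)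
        (solve (t₀ ∷ d ∷ a′ ∷ q ∷ p ∷ e ∷ f ∷ []))
      ...     | inj₂ (inj₂ h) = absurd (8 + 7 * t₀ + 30 * d + 2 * q) (2 ⊗ ≤-reflexive (sym (sum a))
        ⊕ 9 ⊗ ≤-reflexive (sum t) ⊕ 9 ⊗ order t ⊕ 2 ⊗ h) (solve (t₀ ∷ d ∷ a′ ∷ q ∷ p ∷ e ∷ []))

      TTBB-U : ∀ {q₂ p e p′ f a′ q b′ q′} → Unit (t₀ + 2 * d) q₂ →
               Main _>_ (t₀ + 3 * d) p e → Main _>_ (t₀ + 4 * d) p′ f →
               Main _<_ (t₀ + 5 * d) a′ q → Main _<_ (t₀ + 6 * d) b′ q′ → ⊥
      TTBB-U {q₂} {p} {e} {_} {f} {a′} {q} {b′} u t t′ a b with same-p (near 3 4) t t′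
          | same-q (close 5 6) a b
      ... | refl | refl with 4q≤q′ (t<t 3 4) t t′ | 9p≤p′ (t<t 5 6) a b | gap₄ (double u) (main² a)
      ...   | 4e≤f | 9a≤b | inj₂ (inj₁ g) = absurd (3 * t₀ + 11 * q₂) (5 ⊗ ≤-reflexive (sum u)
        ⊕ 2 ⊗ ≤-reflexive (sym (sum a)) ⊕ 2 ⊗ 3≤p (main³ a) ⊕ 2 ⊗ g)
        (solve (t₀ ∷ d ∷ q₂ ∷ a′ ∷ q ∷ []))
      ...   | 4e≤f | 9a≤b | inj₂ (inj₂ g) = absurd (3 + 8 * d) (2 ⊗ ≤-reflexive (sym (sum u))
        ⊕ 2 ⊗ ≤-reflexive (sum b) ⊕ 2 ⊗ order b ⊕ g) (solve (t₀ ∷ d ∷ q₂ ∷ q ∷ b′ ∷ []))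
      ...   | 4e≤f | 9a≤b | inj₁ g with gap₄ (main² a) (main² t′)
      ...     | inj₁ h = absurd (1 + 2 * d) (≤-reflexive (sym (sum t′)) ⊕ ≤-reflexive (sum b)
        ⊕ order b ⊕ order t′ ⊕ 2 ⊗ ≤-reflexive h) (solve (t₀ ∷ d ∷ p ∷ f ∷ q ∷ b′ ∷ []))
      ...     | inj₂ (inj₁ h) = absurd (1 + t₀ + 8 * d + p) (≤-reflexive (sym (sum t′))
        ⊕ 2 ⊗ ≤-reflexive (sum b) ⊕ 2 ⊗ order b ⊕ h) (solve (t₀ ∷ d ∷ p ∷ f ∷ q ∷ b′ ∷ []))
      ...     | inj₂ (inj₂ h) with gap₄ (quadruple (main² t′)) (main² a)
      -- Now q = 4f and q₂ = 2f, so t₅ - t₂ gives 3d = a′ + 2f - 1. With 8a′ ≤ d this yields 23d <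
      -- 16f, against 4d ≥ 3f.
      ...       | inj₁ k = absurd (21 + 10 * t₀) (22 ⊗ ≤-reflexive (sym (sum u))
        ⊕ 112 ⊗ ≤-reflexive (sum t) ⊕ 112 ⊗ ≤-reflexive (sym (sum t′))
        ⊕ 36 ⊗ ≤-reflexive (sum a) ⊕ 4 ⊗ ≤-reflexive (sym (sum b)) ⊕ 28 ⊗ 4e≤f ⊕ 4 ⊗ 9a≤b
        ⊕ 11 ⊗ ≤-reflexive (sym g) ⊕ 21 ⊗ ≤-reflexive (sym k))
        (solve (t₀ ∷ d ∷ q₂ ∷ p ∷ e ∷ f ∷ a′ ∷ q ∷ b′ ∷ []))
      ...       | inj₂ (inj₁ k) = absurd (61 + 8 * d + 2 * b′) (2 ⊗ ≤-reflexive (sum u)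
        ⊕ 16 ⊗ ≤-reflexive (sym (sum t)) ⊕ 16 ⊗ ≤-reflexive (sum t′)
        ⊕ 2 ⊗ ≤-reflexive (sym (sum b)) ⊕ 16 ⊗ 4≤q (main² t) ⊕ ≤-reflexive g ⊕ k)
        (solve (t₀ ∷ d ∷ q₂ ∷ p ∷ e ∷ f ∷ q ∷ b′ ∷ []))
      ...       | inj₂ (inj₂ k) = absurd (3 + 4 * d) (2 ⊗ ≤-reflexive (sym (sum t′))
        ⊕ 2 ⊗ ≤-reflexive (sum b) ⊕ 2 ⊗ order b ⊕ 2 ⊗ order t′ ⊕ k)
        (solve (t₀ ∷ d ∷ p ∷ f ∷ q ∷ b′ ∷ []))

      -- Sizes force q₂ = f = 4e and q = 16e, hence d = 3e, and then no linear contradiction is left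
      -- to use. Divisibility by 9 finishes.
      TTBB-B : ∀ {p₂ q₂ p e p′ f a′ q b′ q′} → Main _<_ (t₀ + 2 * d) p₂ q₂ →
               Main _>_ (t₀ + 3 * d) p e → Main _>_ (t₀ + 4 * d) p′ f →
               Main _<_ (t₀ + 5 * d) a′ q → Main _<_ (t₀ + 6 * d) b′ q′ → ⊥
      TTBB-B {p₂} {q₂} {p} {e} {_} {f} {a′} {q} {b′} s t t′ a b with same-p (near 3 4) t t′
          | same-q (close 5 6) a b
      ... | refl | refl with 4q≤q′ (t<t 3 4) t t′ | 9p≤p′ (t<t 5 6) a b | gap₄ (main² s) (main² a)
      ...   | 4e≤f | 9a≤b | inj₁ refl = BBB′ (t<t 2 5) (t<t 5 6) (spread 2 5 6) s a b
      ...   | 4e≤f | 9a≤b | inj₂ (inj₂ g) =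
        absurd (11 + 35 * d + 2 * p₂) (2 ⊗ ≤-reflexive (sym (sum s))
        ⊕ 9 ⊗ ≤-reflexive (sum a) ⊕ ≤-reflexive (sym (sum b)) ⊕ 9a≤b ⊕ 6 ⊗ 2≤t₀ ⊕ 2 ⊗ g)
        (solve (t₀ ∷ d ∷ p₂ ∷ q₂ ∷ a′ ∷ q ∷ b′ ∷ []))
      ...   | 4e≤f | 9a≤b | inj₂ (inj₁ g) with gap₄ (quadruple (main² s)) (main² a)
      ...     | inj₂ (inj₁ h) = absurd (12 + 2 * t₀ + 10 * p₂ + b′) (3 ⊗ ≤-reflexive (sum s)
        ⊕ ≤-reflexive (sym (sum b)) ⊕ 13 ⊗ order s ⊕ h) (solve (t₀ ∷ d ∷ p₂ ∷ q₂ ∷ q ∷ b′ ∷ []))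
      ...     | inj₂ (inj₂ h) = absurd (2 + 3 * b′) (3 ⊗ order b ⊕ g ⊕ h)
        (solve (q₂ ∷ q ∷ b′ ∷ []))
      ...     | inj₁ 4q₂≡q with gap₄ (main² s) (main² t′)
      ...       | inj₂ (inj₁ h) = absurd (1 + t₀ + p) (2 ⊗ ≤-reflexive (sum s)
        ⊕ ≤-reflexive (sym (sum t′)) ⊕ 2 ⊗ order s ⊕ h) (solve (t₀ ∷ d ∷ p₂ ∷ q₂ ∷ p ∷ f ∷ []))
      ...       | inj₂ (inj₂ h) = absurd (1 + p₂ + 4 * e + b′) (≤-reflexive (sum s)
        ⊕ 4 ⊗ ≤-reflexive (sym (sum t)) ⊕ 4 ⊗ ≤-reflexive (sum t′) ⊕ ≤-reflexive (sym (sum b))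
        ⊕ 2 ⊗ order s ⊕ ≤-reflexive 4q₂≡q ⊕ h)
        (solve (t₀ ∷ d ∷ p₂ ∷ q₂ ∷ p ∷ e ∷ f ∷ q ∷ b′ ∷ []))
      ...       | inj₁ q₂≡f with gap₄ (quadruple (main² t)) (main² t′)
      ...         | inj₂ (inj₁ h) = absurd (291 + 8 * t₀) (39 ⊗ ≤-reflexive (sum t)
        ⊕ 39 ⊗ ≤-reflexive (sym (sum t′)) ⊕ 9 ⊗ ≤-reflexive (sum a) ⊕ ≤-reflexive (sym (sum b))
        ⊕ 9a≤b ⊕ 73 ⊗ 4≤q (main² t) ⊕ 8 ⊗ ≤-reflexive (sym 4q₂≡q) ⊕ 32 ⊗ ≤-reflexive q₂≡f
        ⊕ 7 ⊗ h) (solve (t₀ ∷ d ∷ q₂ ∷ p ∷ e ∷ f ∷ a′ ∷ q ∷ b′ ∷ []))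
      ...         | inj₂ (inj₂ h) = absurd 47 (12 ⊗ 4≤q (main² t) ⊕ 4 ⊗ 4e≤f ⊕ h)
        (solve (e ∷ f ∷ []))
      ...         | inj₁ 4e≡f = endgame
        where
        b≡a+3e : b′ ≡ a′ + 3 * e
        b≡a+3e = squeeze
          (λ lt → absurd 0 (lt ⊕ ≤-reflexive (sym (sum t)) ⊕ ≤-reflexive (sum t′)
            ⊕ ≤-reflexive (sum a) ⊕ ≤-reflexive (sym (sum b)) ⊕ ≤-reflexive (sym 4e≡f))
            (solve (t₀ ∷ d ∷ p ∷ e ∷ f ∷ a′ ∷ q ∷ b′ ∷ [])))
          (λ lt → absurd 0 (lt ⊕ ≤-reflexive (sum t) ⊕ ≤-reflexive (sym (sum t′))
            ⊕ ≤-reflexive (sym (sum a)) ⊕ ≤-reflexive (sum b) ⊕ ≤-reflexive 4e≡f)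
            (solve (t₀ ∷ d ∷ p ∷ e ∷ f ∷ a′ ∷ q ∷ b′ ∷ [])))
        p≡9e+a : p ≡ 9 * e + a′
        p≡9e+a = squeeze
          (λ lt → absurd 0 (lt ⊕ ≤-reflexive (sum t) ⊕ 2 ⊗ ≤-reflexive (sym (sum t′))
            ⊕ ≤-reflexive (sum a) ⊕ ≤-reflexive (sym 4q₂≡q) ⊕ 4 ⊗ ≤-reflexive q₂≡f
            ⊕ 2 ⊗ ≤-reflexive (sym 4e≡f)) (solve (t₀ ∷ d ∷ q₂ ∷ p ∷ e ∷ f ∷ a′ ∷ q ∷ [])))
          (λ lt → absurd 0 (lt ⊕ ≤-reflexive (sym (sum t)) ⊕ 2 ⊗ ≤-reflexive (sum t′)
            ⊕ ≤-reflexive (sym (sum a)) ⊕ ≤-reflexive 4q₂≡q ⊕ 4 ⊗ ≤-reflexive (sym q₂≡f)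
            ⊕ 2 ⊗ ≤-reflexive 4e≡f) (solve (t₀ ∷ d ∷ q₂ ∷ p ∷ e ∷ f ∷ a′ ∷ q ∷ [])))
        9∣b : 9 ∣ b′
        9∣b with 3-power-cases (power³ (main³ b)) (3≤p (main³ b))
        ... | inj₂ h = h
        ... | inj₁ b≡3 = ⊥-elim (absurd 23 (≤-reflexive b≡3 ⊕ 9a≤b ⊕ 9 ⊗ 3≤p (main³ a))
          (solve (a′ ∷ b′ ∷ [])))
        -- If 9 ∣ a′, then b′ = a′ + 3e gives 3 ∣ e. If a′ = 3, then p = 9e + 3 is larger than 3 but
        -- not divisible by 9.
        endgame : ⊥
        endgame with 3-power-cases (power³ (main³ a)) (3≤p (main³ a))
            | 3-power-cases (power³ (main³ t)) (3≤p (main³ t))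
        ... | inj₂ 9∣a | _ =
          3∤2^n (power² (main² t)) (*-cancelˡ-∣ 3 (∣m+n∣m⇒∣n (subst (9 ∣_) b≡a+3e 9∣b) 9∣a))
        ... | inj₁ _ | inj₁ p≡3 = absurd (32 + a′) (≤-reflexive p≡3 ⊕ ≤-reflexive (sym p≡9e+a)
          ⊕ 9 ⊗ 4≤q (main² t)) (solve (p ∷ e ∷ a′ ∷ []))
        ... | inj₁ a≡3 | inj₂ 9∣p = from-no (9 ∣? 3)
          (∣m+n∣m⇒∣n (subst (9 ∣_) (trans p≡9e+a (cong (9 * e +_) a≡3)) 9∣p) (m∣m*n e))

      lag : ∀ i j → {True (2 * j N.≤? 3 * i)} → 2 * term j ≤ 3 * term i + 6
      lag i j {h} = ≮⇒≥ (bound (toWitness h))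
        where
        bound : 2 * j ≤ 3 * i → ¬ 3 * (t₀ + i * d) + 6 < 2 * (t₀ + j * d)
        bound h lt = absurd (6 + t₀) (lt ⊕ h ⊛ d) (solve (t₀ ∷ d ∷ i ∷ j ∷ []))

      spread₉ : ∀ i j k → {True (4 * k + j N.≤? 9 * i)} → 4 * term k + term j ≤ 9 * term i
      spread₉ i j k {h} = ≮⇒≥ (bound (toWitness h))
        where
        bound : 4 * k + j ≤ 9 * i → ¬ 9 * (t₀ + i * d) < 4 * (t₀ + k * d) + (t₀ + j * d)
        bound h lt = absurd (4 * t₀) (lt ⊕ h ⊛ d) (solve (t₀ ∷ d ∷ i ∷ j ∷ k ∷ []))

      spread₁₈ : ∀ k i m → {True (9 * i + 2 * m N.≤? 18 * k)} →
          9 * term i + 2 * term m ≤ 18 * term k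
      spread₁₈ k i m {h} = ≮⇒≥ (bound (toWitness h))
        where
        bound : 9 * i + 2 * m ≤ 18 * k → ¬ 18 * (t₀ + k * d) < 9 * (t₀ + i * d) + 2 * (t₀ + m * d)
        bound h lt = absurd (7 * t₀) (lt ⊕ h ⊛ d) (solve (t₀ ∷ d ∷ i ∷ m ∷ k ∷ []))

      spread₃ : ∀ k m n → {True (k + 2 * m N.≤? 3 * n)} → term k + 2 * term m ≤ 3 * term n
      spread₃ k m n {h} = ≮⇒≥ (bound (toWitness h))
        where
        bound : k + 2 * m ≤ 3 * n → ¬ 3 * (t₀ + n * d) < t₀ + k * d + 2 * (t₀ + m * d)
        bound h lt = absurd 0 (lt ⊕ h ⊛ d) (solve (t₀ ∷ d ∷ n ∷ m ∷ k ∷ []))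

      spread₂ : ∀ k m → {True (k N.≤? 2 * m)} → term k ≤ 2 * term m
      spread₂ k m {h} = ≮⇒≥ (bound (toWitness h))
        where
        bound : k ≤ 2 * m → ¬ 2 * (t₀ + m * d) < t₀ + k * d
        bound h lt = absurd t₀ (lt ⊕ h ⊛ d) (solve (t₀ ∷ d ∷ m ∷ k ∷ []))

      TTBB : ∀ {p e p′ f a′ q b′ q′} → Kind (term 2) →
             Main _>_ (t₀ + 3 * d) p e → Main _>_ (t₀ + 4 * d) p′ f →
             Main _<_ (t₀ + 5 * d) a′ q → Main _<_ (t₀ + 6 * d) b′ q′ → ⊥
      TTBB (B s) t t′ a b = TTBB-B s t t′ a b
      TTBB (T s) t t′ a b = TTT (near 2 3) (near 3 4) (spread 2 3 4) s t t′
      TTBB (U u) t t′ a b = TTBB-U u t t′ a b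
      TTBB (D x) t t′ a b = DT (near 2 3) x t

      -- Forbidden pairs come before forbidden triples and whole patterns. The pair (T, D) survives
      -- only at the indices 3, 5 and 3, 6, where 2j ≤ 3i fails and `TD` does not apply.
      window : Kind (term 2) → Kind (term 3) → Kind (term 4) → Kind (term 5) → Kind (term 6) → ⊥
      window _ (T a) (D b) _ _ = TD (close 3 4) (lag 3 4) a b
      window _ (U a) (B b) _ _ = UB (close 3 4) a b
      window _ (U a) (U b) _ _ = UU (close 3 4) a b
      window _ (D a) (T b) _ _ = DT (near 3 4) a b
      window _ (D a) (D b) _ _ = DD (close 3 4) a b
      window _ (U a) _ (B c) _ = UB (close 3 5) a c
      window _ (U a) _ (U c) _ = UU (close 3 5) a c
      window _ (D a) _ (T c) _ = DT (near 3 5) a c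
      window _ (D a) _ (D c) _ = DD (close 3 5) a c
      window _ (U a) _ _ (B e) = UB (close 3 6) a e
      window _ (U a) _ _ (U e) = UU (close 3 6) a e
      window _ (D a) _ _ (T e) = DT (near 3 6) a e
      window _ (D a) _ _ (D e) = DD (close 3 6) a e
      window _ _ (T b) (D c) _ = TD (close 4 5) (lag 4 5) b c
      window _ _ (U b) (B c) _ = UB (close 4 5) b c
      window _ _ (U b) (U c) _ = UU (close 4 5) b c
      window _ _ (D b) (T c) _ = DT (near 4 5) b c
      window _ _ (D b) (D c) _ = DD (close 4 5) b c
      window _ _ (T b) _ (D e) = TD (close 4 6) (lag 4 6) b e
      window _ _ (U b) _ (B e) = UB (close 4 6) b e
      window _ _ (U b) _ (U e) = UU (close 4 6) b e
      window _ _ (D b) _ (T e) = DT (near 4 6) b e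
      window _ _ (D b) _ (D e) = DD (close 4 6) b e
      window _ _ _ (T c) (D e) = TD (close 5 6) (lag 5 6) c e
      window _ _ _ (U c) (B e) = UB (close 5 6) c e
      window _ _ _ (U c) (U e) = UU (close 5 6) c e
      window _ _ _ (D c) (T e) = DT (near 5 6) c e
      window _ _ _ (D c) (D e) = DD (close 5 6) c e
      window _ (B a) (B b) (B c) _ = BBB (close 3 4) (close 4 5) (spread 3 4 5) a b c
      window _ (B a) (B b) (U c) _ = BBU (close 3 4) (close 4 5) (spread₉ 3 4 5) a b c
      window _ (T a) (T b) (T c) _ = TTT (near 3 4) (near 4 5) (spread 3 4 5) a b c
      window _ (B a) (B b) _ (B e) = BBB (close 3 4) (close 4 6) (spread 3 4 6) a b e
      window _ (T a) (T b) _ (T e) = TTT (near 3 4) (near 4 6) (spread 3 4 6) a b e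
      window _ (B a) _ (B c) (B e) = BBB (close 3 5) (close 5 6) (spread 3 5 6) a c e
      window _ (T a) _ (T c) (T e) = TTT (near 3 5) (near 5 6) (spread 3 5 6) a c e
      window _ _ (T b) (T c) (T e) = TTT (near 4 5) (near 5 6) (spread 4 5 6) b c e
      window _ _ (B b) (B c) (B e) = BBB (close 4 5) (close 5 6) (spread 4 5 6) b c e
      window _ _ (B b) (B c) (U e) = BBU (close 4 5) (close 5 6) (spread₉ 4 5 6) b c e
      window r (B a) (B b) (T c) (T e) =
        settle (close 2 3) (close 3 4) (spread 2 3 4) (near 2 5) (near 5 6) (spread 2 5 6)
        a b c e r
      window _ (B a) (B b) (T c) (U e) = BBTU a b c e
      window _ (B a) (B b) (D c) (U e) = BBDU a b c e
      window r (B a) (T b) (B c) (T e) =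
        settle (close 2 3) (close 3 5) (spread 2 3 5) (near 2 4) (near 4 6) (spread 2 4 6)
        a c b e r
      window _ (B a) (T b) (B c) (U e) = BTBU a b c e
      window r (B a) (T b) (T c) (B e) =
        settle (close 2 3) (close 3 6) (spread 2 3 6) (near 2 4) (near 4 5) (spread 2 4 5)
        a e b c r
      window _ (B a) (T b) (T c) (U e) = BTTU a b c e
      window _ (B a) (T b) (U c) (T e) =
        BUTT (close 3 5) (near 4 6) (spread₃ 3 4 6) (spread₁₈ 3 5 4) (spread₂ 3 4)
        a c b e
      window _ (B a) (U b) (T c) (T e) =
        BUTT (close 3 4) (near 5 6) (spread₃ 3 5 6) (spread₁₈ 3 4 5) (spread₂ 3 5)
        a b c e
      window _ (B a) (D b) (B c) (U e) = BDBU a b c e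
      window r (T a) (B b) (B c) (T e) =
        settle (close 2 4) (close 4 5) (spread 2 4 5) (near 2 3) (near 3 6) (spread 2 3 6)
        b c a e r
      window _ (T a) (B b) (B c) (D e) = TBBD a b c e
      window r (T a) (B b) (T c) (B e) =
        settle (close 2 4) (close 4 6) (spread 2 4 6) (near 2 3) (near 3 5) (spread 2 3 5)
        b e a c r
      window _ (T a) (B b) (T c) (U e) =
        BUTT (close 4 6) (near 3 5) (spread₃ 4 3 5) (spread₁₈ 4 6 3) (spread₂ 4 3)
        b e a c
      window _ (T a) (B b) (U c) (T e) =
        BUTT (close 4 5) (near 3 6) (spread₃ 4 3 6) (spread₁₈ 4 5 3) (spread₂ 4 3)
        b c a e
      window _ (T a) (B b) (U c) (D e) = TBUD a b c e
      window _ (T a) (B b) (D c) (B e) = TBDB a b c e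
      window _ (T a) (B b) (D c) (U e) = TBDU a b c e
      window r (T a) (T b) (B c) (B e) = TTBB r a b c e
      window _ (T a) (T b) (B c) (U e) =
        BUTT (close 5 6) (near 3 4) (spread₃ 5 3 4) (spread₁₈ 5 6 3) (spread₂ 5 3)
        c e a b

  -- Residues modulo 24

  -- `odd` and `even` refer to the parity of the exponent, here and in `Residue²`.
  data Residue³ (p : ℕ) : ℕ → Set where
    one  : p ≡ 1 → Residue³ p 1
    odd  : 3 ≤ p → p % 24 ≡ 3 → Residue³ p 3
    even : 3 ≤ p → p % 24 ≡ 9 → Residue³ p 9

  data Residue² (q : ℕ) : ℕ → Set where
    one  : q ≡ 1 → Residue² q 1
    two  : q ≡ 2 → Residue² q 2
    four : q ≡ 4 → Residue² q 4
    odd  : 4 ≤ q → q % 24 ≡ 8 → Residue² q 8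
    even : 4 ≤ q → q % 24 ≡ 16 → Residue² q 16

  residue³ : ∀ {p} → IsPower 3 p → ∃ (Residue³ p)
  residue³ (zero , refl) = 1 , one refl
  residue³ (suc n , refl) with cycle n
    where
    cycle : ∀ n → 3 ^ suc n % 24 ≡ 3 ⊎ 3 ^ suc n % 24 ≡ 9
    cycle zero = inj₁ refl
    cycle (suc n) with cycle n | [m*n]%o≡[m*[n%o]]%o 3 (3 ^ suc n) 24
    ... | inj₁ eq | step = inj₂ (trans step (cong (λ r → (3 * r) % 24) eq))
    ... | inj₂ eq | step = inj₁ (trans step (cong (λ r → (3 * r) % 24) eq))
  ... | inj₁ eq = 3 , odd (^-monoʳ-≤ 3 {1} {suc n} (s≤s z≤n)) eq
  ... | inj₂ eq = 9 , even (^-monoʳ-≤ 3 {1} {suc n} (s≤s z≤n)) eq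

  residue² : ∀ {q} → IsPower 2 q → ∃ (Residue² q)
  residue² (0 , refl) = 1 , one refl
  residue² (1 , refl) = 2 , two refl
  residue² (2 , refl) = 4 , four refl
  residue² (suc (suc (suc n)) , refl) with cycle n
    where
    cycle : ∀ n → 2 ^ (3 + n) % 24 ≡ 8 ⊎ 2 ^ (3 + n) % 24 ≡ 16
    cycle zero = inj₁ refl
    cycle (suc n) with cycle n | [m*n]%o≡[m*[n%o]]%o 2 (2 ^ (3 + n)) 24
    ... | inj₁ eq | step = inj₂ (trans step (cong (λ r → (2 * r) % 24) eq))
    ... | inj₂ eq | step = inj₁ (trans step (cong (λ r → (2 * r) % 24) eq))
  ... | inj₁ eq = 8 , odd (^-monoʳ-≤ 2 {2} {3 + n} (s≤s (s≤s z≤n))) eq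
  ... | inj₂ eq = 16 , even (^-monoʳ-≤ 2 {2} {3 + n} (s≤s (s≤s z≤n))) eq

  mod³ : ∀ {p r} → Residue³ p r → p % 24 ≡ r
  mod³ (one refl) = refl
  mod³ (odd _ eq) = eq
  mod³ (even _ eq) = eq

  mod² : ∀ {q s} → Residue² q s → q % 24 ≡ s
  mod² (one refl) = refl
  mod² (two refl) = refl
  mod² (four refl) = refl
  mod² (odd _ eq) = eq
  mod² (even _ eq) = eq

  residues³ residues² : List ℕ
  residues³ = 1 ∷ 3 ∷ 9 ∷ []
  residues² = 1 ∷ 2 ∷ 4 ∷ 8 ∷ 16 ∷ []

  member³ : ∀ {p r} → Residue³ p r → r ∈ residues³
  member³ (one _) = here refl
  member³ (odd _ _) = there (here refl)
  member³ (even _ _) = there (there (here refl))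

  member² : ∀ {q s} → Residue² q s → s ∈ residues²
  member² (one _) = here refl
  member² (two _) = there (here refl)
  member² (four _) = there (there (here refl))
  member² (odd _ _) = there (there (there (here refl)))
  member² (even _ _) = there (there (there (there (here refl))))

  %24%8 : ∀ p → p % 24 % 8 ≡ p % 8
  %24%8 p = m∣n⇒o%n%m≡o%m 8 24 p (divides 3 refl)

  %24%3 : ∀ q → q % 24 % 3 ≡ q % 3
  %24%3 q = m∣n⇒o%n%m≡o%m 3 24 q (divides 8 refl)

  %24%12 : ∀ t → t % 24 % 12 ≡ t % 12
  %24%12 t = m∣n⇒o%n%m≡o%m 12 24 t (divides 2 refl)

  record Summands (t : ℕ) : Set where
    constructor summands
    field
      {p q}  : ℕ
      power³ : IsPower 3 p
      power² : IsPower 2 q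
      total  : t ≡ p + q

  record Classes (t p q : ℕ) : Set where
    constructor classes
    field
      {r s}    : ℕ
      residue₃ : Residue³ p r
      residue₂ : Residue² q s
      total    : t % 24 ≡ (r + s) % 24

  classify : ∀ {p q} → IsPower 3 p → IsPower 2 q → Classes (p + q) p q
  classify {p} {q} w v with residue³ w | residue² v
  ... | _ , a | _ , b = classes a b
    (trans (%-distribˡ-+ p q 24) (cong₂ (λ r s → (r + s) % 24) (mod³ a) (mod² b)))

  -- The implication is decided on the fifteen pairs of possible residues.
  force : ∀ {P : ℕ → Set} {Q : ℕ → ℕ → Set} (P? : ∀ n → Dec (P n)) (Q? : ∀ r s → Dec (Q r s)) →
          {True (all? (λ r → all? (λ s → P? ((r + s) % 24) →-dec Q? r s) residues²) residues³)} →
          ∀ {t p q} (C : Classes t p q) → P (t % 24) → Q (Classes.r C) (Classes.s C)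
  force {P} P? Q? {ok} (classes a b eq) h =
    All.lookup (All.lookup (toWitness ok) (member³ a)) (member² b) (subst P eq h)

  -- Residues modulo 24 forcing y = 0; forcing x = 0 and y odd; forcing y = 2; and
  -- not attained at all.
  Even Triple PlusFour Impossible : ℕ → Set
  Even n = n % 2 ≡ 0
  Triple n = n % 3 ≡ 0
  PlusFour n = n ≡ 7 ⊎ n ≡ 13
  Impossible n = n ≡ 23

  Even? : ∀ n → Dec (Even n)
  Even? n = n % 2 N.≟ 0

  Triple? : ∀ n → Dec (Triple n)
  Triple? n = n % 3 N.≟ 0

  PlusFour? : ∀ n → Dec (PlusFour n)
  PlusFour? n = n N.≟ 7 ⊎-dec n N.≟ 13

  Impossible? : ∀ n → Dec (Impossible n)
  Impossible? n = n N.≟ 23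

  Power³Plus : ℕ → ℕ → Set
  Power³Plus c t = ∃ λ p → IsPower 3 p × t ≡ p + c

  OnePlusOddPower² : ℕ → Set
  OnePlusOddPower² t = ∃ λ q → IsPower 2 q × q % 3 ≡ 2 × t ≡ 1 + q

  even-summands : ∀ {t} → Summands t → Even (t % 24) → Power³Plus 1 t
  even-summands (summands w v refl) h with classify w v
  ... | C@(classes _ b _) with force Even? (λ r s → s N.≟ 1) C h | b
  ...   | refl | one refl = _ , w , refl

  triple-summands : ∀ {t} → Summands t → Triple (t % 24) → OnePlusOddPower² t
  triple-summands (summands {q = q} w v refl) h with classify w v
  ... | C@(classes a b _) with force Triple? (λ r s → r N.≟ 1 ×-dec (s N.≟ 2 ⊎-dec s N.≟ 8)) C h
      | a | b
  ...   | refl , inj₁ refl | one refl | two refl = _ , v , refl , refl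
  ...   | refl , inj₂ refl | one refl | odd _ eq =
    _ , v , trans (sym (%24%3 q)) (cong (_% 3) eq) , refl

  plus-four-summands : ∀ {t} → Summands t → PlusFour (t % 24) → Power³Plus 4 t
  plus-four-summands (summands w v refl) h with classify w v
  ... | C@(classes _ b _) with force PlusFour? (λ r s → s N.≟ 4) C h | b
  ...   | refl | four refl = _ , w , refl

  ¬impossible-summands : ∀ {t} → Summands t → ¬ Impossible (t % 24)
  ¬impossible-summands (summands w v refl) h =
    force Impossible? (λ _ _ → no λ ()) (classify w v) h

  -- Size obstructions to the special shapes

  no-even-triple : ∀ {s t u p p′ p″} → s < t → u + s ≡ 2 * t → IsPower 3 p′ → IsPower 3 p″ →
                   s ≡ p + 1 → t ≡ p′ + 1 → u ≡ p″ + 1 → ⊥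
  no-even-triple {s} {t} {u} {p} {p′} {p″} lt mid w v a b c with power-gap 3 w v
  ... | inj₁ refl = absurd 0 (lt ⊕ ≤-reflexive (sym mid) ⊕ ≤-reflexive (sym b) ⊕ ≤-reflexive c)
    (solve (s ∷ t ∷ u ∷ p′ ∷ []))
  ... | inj₂ (inj₁ g) = absurd p (≤-reflexive mid ⊕ ≤-reflexive (sym a) ⊕ 2 ⊗ ≤-reflexive b
    ⊕ ≤-reflexive (sym c) ⊕ g ⊕ power-positive w) (solve (s ∷ t ∷ u ∷ p ∷ p′ ∷ p″ ∷ []))
  ... | inj₂ (inj₂ g) = absurd (2 + 2 * s) (5 ⊗ lt ⊕ 3 ⊗ ≤-reflexive (sym mid)
    ⊕ ≤-reflexive (sym b) ⊕ 3 ⊗ ≤-reflexive c ⊕ g) (solve (s ∷ t ∷ u ∷ p′ ∷ p″ ∷ []))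

  -- Equal classes modulo 3 make the larger power at least four times the smaller, but s ≥ d + 2
  -- keeps t = s + 3d below 4s - 3. This bound on `s` is why the pair at indices 0 and 3 is not
  -- among the outcomes.
  no-triple-pair : ∀ {s t d q q′} → 1 ≤ d → 2 + d ≤ s → t ≡ s + 3 * d →
                   IsPower 2 q → IsPower 2 q′ → q % 3 ≡ 2 → q′ % 3 ≡ 2 → s ≡ 1 + q → t ≡ 1 + q′ → ⊥
  no-triple-pair {s} {t} {d} {q} {q′} 1≤d h step w v qm q′m a b
      with power-gap₄ w v (trans qm (sym q′m))
  ... | inj₁ refl = absurd 2 (3 ⊗ 1≤d ⊕ ≤-reflexive (sym step) ⊕ ≤-reflexive (sym a)
    ⊕ ≤-reflexive b) (solve (s ∷ t ∷ d ∷ q ∷ []))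
  ... | inj₂ (inj₁ g) = absurd 2 (3 ⊗ h ⊕ ≤-reflexive step ⊕ 4 ⊗ ≤-reflexive a
    ⊕ ≤-reflexive (sym b) ⊕ g) (solve (s ∷ t ∷ d ∷ q ∷ q′ ∷ []))
  ... | inj₂ (inj₂ g) = absurd (8 + 3 * s) (12 ⊗ 1≤d ⊕ 4 ⊗ ≤-reflexive (sym step)
    ⊕ ≤-reflexive (sym a) ⊕ 4 ⊗ ≤-reflexive b ⊕ g) (solve (s ∷ t ∷ d ∷ q ∷ q′ ∷ []))

  -- From p₅ - p₁ = 4(p₁ - p₀) and p₁ ≥ 3p₀ it follows that p₅ lies strictly between 3p₁ and 9p₁.
  no-plus-four-015 : ∀ {s d p₀ p₁ p₅} → 1 ≤ d → IsPower 3 p₀ → IsPower 3 p₁ → IsPower 3 p₅ →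
                       s ≡ p₀ + 4 → s + 1 * d ≡ p₁ + 4 → s + 5 * d ≡ p₅ + 4 → ⊥
  no-plus-four-015 {s} {d} {p₀} {p₁} {p₅} 1≤d w₀ w₁ w₅ a b c with power-gap 3 w₀ w₁
  ... | inj₁ refl = absurd 0 (1≤d ⊕ ≤-reflexive (sym a) ⊕ ≤-reflexive b)
    (solve (s ∷ d ∷ p₀ ∷ []))
  ... | inj₂ (inj₂ g) = absurd (2 + 2 * p₀) (3 ⊗ 1≤d ⊕ 3 ⊗ ≤-reflexive (sym a)
    ⊕ 3 ⊗ ≤-reflexive b ⊕ g) (solve (s ∷ d ∷ p₀ ∷ p₁ ∷ []))
  ... | inj₂ (inj₁ g) with power-gap 3 w₁ w₅
  ...   | inj₁ refl = absurd 3 (4 ⊗ 1≤d ⊕ ≤-reflexive (sym b) ⊕ ≤-reflexive c)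
    (solve (s ∷ d ∷ p₁ ∷ []))
  ...   | inj₂ (inj₂ h) = absurd (5 + 2 * s) (14 ⊗ 1≤d ⊕ ≤-reflexive (sym b) ⊕ 3 ⊗ ≤-reflexive c
    ⊕ h) (solve (s ∷ d ∷ p₁ ∷ p₅ ∷ []))
  ...   | inj₂ (inj₁ h) with power-gap 3 (power-suc w₁) w₅
  ...     | inj₁ k = absurd 0 (1≤d ⊕ 3 ⊗ ≤-reflexive a ⊕ 4 ⊗ ≤-reflexive (sym b) ⊕ ≤-reflexive c
    ⊕ g ⊕ ≤-reflexive (sym k)) (solve (s ∷ d ∷ p₀ ∷ p₁ ∷ p₅ ∷ []))
  ...     | inj₂ (inj₁ k) = absurd (3 + 8 * p₀) (4 ⊗ 1≤d ⊕ 8 ⊗ ≤-reflexive (sym a)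
    ⊕ 9 ⊗ ≤-reflexive b ⊕ ≤-reflexive (sym c) ⊕ k) (solve (s ∷ d ∷ p₀ ∷ p₁ ∷ p₅ ∷ []))
  ...     | inj₂ (inj₂ k) = absurd 11 (12 ⊗ 1≤d ⊕ 3 ⊗ ≤-reflexive (sym b) ⊕ 3 ⊗ ≤-reflexive c
    ⊕ k) (solve (s ∷ d ∷ p₁ ∷ p₅ ∷ []))

  no-plus-four-034 : ∀ {s d p₀ p₃ p₄} → 1 ≤ d → IsPower 3 p₃ → IsPower 3 p₄ →
                       s ≡ p₀ + 4 → s + 3 * d ≡ p₃ + 4 → s + 4 * d ≡ p₄ + 4 → ⊥
  no-plus-four-034 {s} {d} {p₀} {p₃} {p₄} 1≤d w₃ w₄ a b c with power-gap 3 w₃ w₄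
  ... | inj₁ refl = absurd 0 (1≤d ⊕ ≤-reflexive (sym b) ⊕ ≤-reflexive c)
    (solve (s ∷ d ∷ p₃ ∷ []))
  ... | inj₂ (inj₁ g) = absurd (4 + 2 * p₀) (5 ⊗ 1≤d ⊕ 2 ⊗ ≤-reflexive (sym a)
    ⊕ 3 ⊗ ≤-reflexive b ⊕ ≤-reflexive (sym c) ⊕ g) (solve (s ∷ d ∷ p₀ ∷ p₃ ∷ p₄ ∷ []))
  ... | inj₂ (inj₂ g) = absurd (2 * s) (9 ⊗ 1≤d ⊕ ≤-reflexive (sym b) ⊕ 3 ⊗ ≤-reflexive c ⊕ g)
    (solve (s ∷ d ∷ p₃ ∷ p₄ ∷ []))

  no-plus-four-23 : ∀ {s d p p′} → 1 ≤ d → 2 * d + 2 ≤ s → IsPower 3 p → IsPower 3 p′ →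
                      s ≡ p + 4 → s + 1 * d ≡ p′ + 4 → ⊥
  no-plus-four-23 {s} {d} {p} {p′} 1≤d h w v a b with power-gap 3 w v
  ... | inj₁ refl = absurd 0 (1≤d ⊕ ≤-reflexive (sym a) ⊕ ≤-reflexive b)
    (solve (s ∷ d ∷ p ∷ []))
  ... | inj₂ (inj₁ g) = absurd 0 (h ⊕ 3 ⊗ ≤-reflexive a ⊕ 2 ⊗ ≤-reflexive (sym b) ⊕ 2 ⊗ g
    ⊕ 3 ⊗ power-positive w) (solve (s ∷ d ∷ p ∷ p′ ∷ []))
  ... | inj₂ (inj₂ g) = absurd (2 + 2 * p) (3 ⊗ 1≤d ⊕ 3 ⊗ ≤-reflexive (sym a)
    ⊕ 3 ⊗ ≤-reflexive b ⊕ g) (solve (s ∷ d ∷ p ∷ p′ ∷ []))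

  -- The table of residues of the first term and the difference

  module Residues (r s : ℕ) where

    x : ℕ → ℕ
    x k = (r + k * s) % 24

    -- All alternatives but the last are contradictory. The last says that 12 ∣ d and that the terms
    -- are prime to 12. The selected index sets are enough to cover all 576 pairs of residues.
    Outcome : Set
    Outcome =
      (Even (x 0) × Even (x 2) × Even (x 4)) ⊎
      (Even (x 1) × Even (x 3) × Even (x 5)) ⊎
      (Triple (x 1) × Triple (x 4)) ⊎
      (Triple (x 2) × Triple (x 5)) ⊎
      (Triple (x 3) × Triple (x 6)) ⊎
      (Impossible (x 0) ⊎ Impossible (x 1) ⊎ Impossible (x 2) ⊎ Impossible (x 3)) ⊎
      (PlusFour (x 0) × PlusFour (x 1) × PlusFour (x 5)) ⊎
      (PlusFour (x 1) × PlusFour (x 2) × PlusFour (x 6)) ⊎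
      (PlusFour (x 2) × PlusFour (x 3)) ⊎
      (PlusFour (x 0) × PlusFour (x 3) × PlusFour (x 4)) ⊎
      (s % 12 ≡ 0 × r % 12 ∈ 1 ∷ 5 ∷ 7 ∷ 11 ∷ [])

    Outcome? : Dec Outcome
    Outcome? =
      (Even? (x 0) ×-dec Even? (x 2) ×-dec Even? (x 4)) ⊎-dec
      (Even? (x 1) ×-dec Even? (x 3) ×-dec Even? (x 5)) ⊎-dec
      (Triple? (x 1) ×-dec Triple? (x 4)) ⊎-dec
      (Triple? (x 2) ×-dec Triple? (x 5)) ⊎-dec
      (Triple? (x 3) ×-dec Triple? (x 6)) ⊎-dec
      (Impossible? (x 0) ⊎-dec Impossible? (x 1) ⊎-dec
       Impossible? (x 2) ⊎-dec Impossible? (x 3)) ⊎-dec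
      (PlusFour? (x 0) ×-dec PlusFour? (x 1) ×-dec PlusFour? (x 5)) ⊎-dec
      (PlusFour? (x 1) ×-dec PlusFour? (x 2) ×-dec PlusFour? (x 6)) ⊎-dec
      (PlusFour? (x 2) ×-dec PlusFour? (x 3)) ⊎-dec
      (PlusFour? (x 0) ×-dec PlusFour? (x 3) ×-dec PlusFour? (x 4)) ⊎-dec
      (s % 12 N.≟ 0 ×-dec r % 12 ∈? 1 ∷ 5 ∷ 7 ∷ 11 ∷ [])

  outcome : ∀ t d → Residues.Outcome (t % 24) (d % 24)
  outcome t d = subst₂ Residues.Outcome (toℕ-fromℕ< (m%n<n t 24)) (toℕ-fromℕ< (m%n<n d 24))
    (table (fromℕ< (m%n<n t 24)) (fromℕ< (m%n<n d 24)))
    where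
    table : ∀ (r s : Fin 24) → Residues.Outcome (toℕ r) (toℕ s)
    table =
      from-yes (Fin.all? {n = 24} λ r → Fin.all? {n = 24} λ s → Residues.Outcome? (toℕ r) (toℕ s))

  -- From residues to kinds of terms

  admissible? : ∀ c → Dec (c ∈ 1 ∷ 5 ∷ 7 ∷ 11 ∷ [])
  admissible? c = c ∈? 1 ∷ 5 ∷ 7 ∷ 11 ∷ []

  main-kind : ∀ ρ σ {p q r s} → IsPower 3 p → IsPower 2 q → 3 ≤ p → 4 ≤ q →
              p % 24 ≡ r → q % 24 ≡ s → r % 8 ≡ ρ → s % 3 ≡ σ → r ≢ s → Terms.Kind ρ σ (p + q)
  main-kind ρ σ {p} {q} w v 3≤p 4≤q refl refl r%8 s%3 r≢s = compare (<-cmp p q)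
    where
    open Terms ρ σ
    P : Main³ p
    P = record { power³ = w ; class³ = trans (sym (%24%8 p)) r%8 ; 3≤p = 3≤p }
    Q : Main² q
    Q = record { power² = v ; class² = trans (sym (%24%3 q)) s%3 ; 4≤q = 4≤q }
    compare : Tri (p < q) (p ≡ q) (p > q) → Kind (p + q)
    compare (tri< p<q _ _) = B (record { sum = refl ; main³ = P ; main² = Q ; order = p<q })
    compare (tri≈ _ refl _) = ⊥-elim (r≢s refl)
    compare (tri> _ _ p>q) = T (record { sum = refl ; main³ = P ; main² = Q ; order = p>q })

  unit-kind : ∀ {q} → IsPower 2 q → 4 ≤ q → q % 3 ≡ 1 → Terms.Kind 1 2 (1 + q)
  unit-kind {q} v 4≤q class = Terms.U (record
    { ρ≡1 = refl ; σ≡2 = refl ; power = v ; other = class ; 4≤ = 4≤q ; sum = +-comm 1 q })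

  double-kind : ∀ ρ {p r} → IsPower 3 p → 3 ≤ p → p % 24 ≡ r → r % 8 ≢ ρ → Terms.Kind ρ 2 (p + 2)
  double-kind ρ {p} w 3≤p refl class = Terms.D (record
    { σ≡2 = refl ; power = w ; other = λ eq → class (trans (%24%8 p) eq) ; 3≤ = 3≤p ; sum = refl })

  -- In an ordinary term 4 divides 2^y and 3 divides 3^x, so t mod 4 is 3^x mod 4, which for a power
  -- of 3 is already its residue modulo 8, and t mod 3 is 2^y mod 3.
  kind : ∀ {t c} → Summands t → t % 12 ≡ c → c ∈ 1 ∷ 5 ∷ 7 ∷ 11 ∷ [] → Terms.Kind (c % 4) (c % 3) t
  kind {t} {c} (summands {p} {q} w v refl) eq c∈ with classify w v
  ... | classes {r} {s} a b total = subst (λ c → Terms.Kind (c % 4) (c % 3) t) r+s≡c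
          (cases w v a b (fromWitness (subst (_∈ _) (sym r+s≡c) c∈)))
    where
    r+s≡c : (r + s) % 24 % 12 ≡ c
    r+s≡c = trans (cong (_% 12) (sym total)) (trans (%24%12 t) eq)
    cases : ∀ {p q r s} → IsPower 3 p → IsPower 2 q → Residue³ p r → Residue² q s →
            let c = (r + s) % 24 % 12 in True (admissible? c) → Terms.Kind (c % 4) (c % 3) (p + q)
    cases w v (odd 3≤ r) (four refl) _ = main-kind 3 1 w v 3≤ ≤-refl r refl refl refl λ ()
    cases w v (odd 3≤ r) (odd 4≤ s) _ = main-kind 3 2 w v 3≤ 4≤ r s refl refl λ ()
    cases w v (odd 3≤ r) (even 4≤ s) _ = main-kind 3 1 w v 3≤ 4≤ r s refl refl λ ()
    cases w v (even 3≤ r) (four refl) _ = main-kind 1 1 w v 3≤ ≤-refl r refl refl refl λ ()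
    cases w v (even 3≤ r) (odd 4≤ s) _ = main-kind 1 2 w v 3≤ 4≤ r s refl refl λ ()
    cases w v (even 3≤ r) (even 4≤ s) _ = main-kind 1 1 w v 3≤ 4≤ r s refl refl λ ()
    cases w v (one refl) (four refl) _ = unit-kind v ≤-refl refl
    cases {q = q} w v (one refl) (even 4≤ s) _ =
      unit-kind v 4≤ (trans (sym (%24%3 q)) (cong (_% 3) s))
    cases w v (odd 3≤ r) (two refl) _ = double-kind 1 w 3≤ r λ ()
    cases w v (even 3≤ r) (two refl) _ = double-kind 3 w 3≤ r λ ()
    cases w v (one _) (one _) ()
    cases w v (one _) (two _) ()
    cases w v (one _) (odd _ _) ()
    cases w v (odd _ _) (one _) ()
    cases w v (even _ _) (one _) ()

  -- Progressions of natural numbers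

  no-seven-terms : ∀ t₀ d → 1 ≤ d → ¬ (∀ k → k < 7 → Summands (t₀ + k * d))
  no-seven-terms t₀ d 1≤d summand = by-outcome (outcome t₀ d)
    where
    term : ℕ → ℕ
    term k = t₀ + k * d

    at : ∀ k → {True (k N.<? 7)} → Summands (term k)
    at k {k<7} = summand k (toWitness k<7)

    2≤t₀ : 2 ≤ t₀
    2≤t₀ with at 0
    ... | summands w v eq =
      subst (2 ≤_) (trans (sym eq) (+-identityʳ t₀)) (power-positive w ⊕ power-positive v)

    open Residues (t₀ % 24) (d % 24)

    residue : ∀ k → term k % 24 ≡ x k
    residue k = begin
      (t₀ + k * d) % 24
        ≡⟨ %-distribˡ-+ t₀ (k * d) 24 ⟩
      (t₀ % 24 + (k * d) % 24) % 24
        ≡⟨ cong (λ m → (t₀ % 24 + m) % 24) ([m*n]%o≡[m*[n%o]]%o k d 24) ⟩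
      (t₀ % 24 + (k * (d % 24)) % 24) % 24
        ≡⟨ cong (λ m → (m + (k * (d % 24)) % 24) % 24) (sym (m%n%n≡m%n t₀ 24)) ⟩
      (t₀ % 24 % 24 + (k * (d % 24)) % 24) % 24
        ≡⟨ sym (%-distribˡ-+ (t₀ % 24) (k * (d % 24)) 24) ⟩
      x k ∎
      where open ≡-Reasoning

    shift : ∀ i j → t₀ + i * d + j * d ≡ t₀ + (j + i) * d
    shift i j = solve (t₀ ∷ d ∷ i ∷ j ∷ [])

    even-term : ∀ k {k<7 : True (k N.<? 7)} → Even (x k) →
                Power³Plus 1 (term k)
    even-term k {k<7} h = even-summands (at k {k<7}) (subst Even (sym (residue k)) h)

    triple-term : ∀ k {k<7 : True (k N.<? 7)} → Triple (x k) →
                  OnePlusOddPower² (term k)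
    triple-term k {k<7} h = triple-summands (at k {k<7}) (subst Triple (sym (residue k)) h)

    plus-four-term : ∀ k {k<7 : True (k N.<? 7)} → PlusFour (x k) →
                      Power³Plus 4 (term k)
    plus-four-term k {k<7} h = plus-four-summands (at k {k<7}) (subst PlusFour (sym (residue k)) h)

    impossible-term : ∀ k {k<7 : True (k N.<? 7)} → ¬ Impossible (x k)
    impossible-term k {k<7} h =
      ¬impossible-summands (at k {k<7}) (subst Impossible (sym (residue k)) h)

    even-triple : ∀ i → Power³Plus 1 (term i) → Power³Plus 1 (term (2 + i)) →
        Power³Plus 1 (term (4 + i)) → ⊥
    even-triple i (_ , _ , a) (_ , w , b) (_ , v , c) = no-even-triple
      (+-monoʳ-< t₀ (*-monoˡ-< d {{N.>-nonZero 1≤d}} (m<n+m i {2} z<s))) middle w v a b c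
      where
      middle : t₀ + (4 + i) * d + (t₀ + i * d) ≡ 2 * (t₀ + (2 + i) * d)
      middle = solve (t₀ ∷ d ∷ i ∷ [])

    triple-pair : ∀ i → OnePlusOddPower² (term (1 + i)) → OnePlusOddPower² (term (4 + i)) → ⊥
    triple-pair i (_ , w , m , a) (_ , v , n , b) =
      no-triple-pair 1≤d (2≤t₀ ⊕ m≤m+n d (i * d)) (sym (shift (1 + i) 3)) w v m n a b

    plus-four-015 : ∀ i → Power³Plus 4 (term i) → Power³Plus 4 (term (1 + i)) →
                      Power³Plus 4 (term (5 + i)) → ⊥
    plus-four-015 i (_ , w , a) (_ , v , b) (_ , u , c) =
      no-plus-four-015 1≤d w v u a (trans (shift i 1) b) (trans (shift i 5) c)

    by-outcome : Outcome → ⊥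
    by-outcome (inj₁ (h , h′ , h″)) =
      even-triple 0 (even-term 0 h) (even-term 2 h′) (even-term 4 h″)
    by-outcome (inj₂ (inj₁ (h , h′ , h″))) =
      even-triple 1 (even-term 1 h) (even-term 3 h′) (even-term 5 h″)
    by-outcome (inj₂ (inj₂ (inj₁ (h , h′)))) = triple-pair 0 (triple-term 1 h) (triple-term 4 h′)
    by-outcome (inj₂ (inj₂ (inj₂ (inj₁ (h , h′))))) =
      triple-pair 1 (triple-term 2 h) (triple-term 5 h′)
    by-outcome (inj₂ (inj₂ (inj₂ (inj₂ (inj₁ (h , h′)))))) =
      triple-pair 2 (triple-term 3 h) (triple-term 6 h′)
    by-outcome (inj₂ (inj₂ (inj₂ (inj₂ (inj₂ (inj₁ h)))))) with h
    ... | inj₁ h = impossible-term 0 h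
    ... | inj₂ (inj₁ h) = impossible-term 1 h
    ... | inj₂ (inj₂ (inj₁ h)) = impossible-term 2 h
    ... | inj₂ (inj₂ (inj₂ h)) = impossible-term 3 h
    by-outcome (inj₂ (inj₂ (inj₂ (inj₂ (inj₂ (inj₂ (inj₁ (h , h′ , h″)))))))) =
      plus-four-015 0 (plus-four-term 0 h) (plus-four-term 1 h′) (plus-four-term 5 h″)
    by-outcome (inj₂ (inj₂ (inj₂ (inj₂ (inj₂ (inj₂ (inj₂ (inj₁ (h , h′ , h″))))))))) =
      plus-four-015 1 (plus-four-term 1 h) (plus-four-term 2 h′) (plus-four-term 6 h″)
    by-outcome (inj₂ (inj₂ (inj₂ (inj₂ (inj₂ (inj₂ (inj₂ (inj₂ (inj₁ (h , h′))))))))))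
      with plus-four-term 2 h | plus-four-term 3 h′
    ... | _ , w , a | _ , v , b = no-plus-four-23 1≤d
      (≤-trans (≤-reflexive (+-comm (2 * d) 2)) (2≤t₀ ⊕ ≤-refl)) w v a (trans (shift 2 1) b)
    by-outcome (inj₂ (inj₂ (inj₂ (inj₂ (inj₂ (inj₂ (inj₂ (inj₂ (inj₂ (inj₁ (h , h′ , h″)))))))))))
      with plus-four-term 0 h | plus-four-term 3 h′ | plus-four-term 4 h″
    ... | _ , _ , a | _ , w , b | _ , v , c =
      no-plus-four-034 1≤d w v a (trans (shift 0 3) b) (trans (shift 0 4) c)
    by-outcome (inj₂ (inj₂ (inj₂ (inj₂ (inj₂ (inj₂ (inj₂ (inj₂ (inj₂ (inj₂ (s%12 , r%12))))))))))) =
      window (kind′ 2) (kind′ 3) (kind′ 4) (kind′ 5) (kind′ 6)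
      where
      12∣d : 12 ∣ d
      12∣d = m%n≡0⇒n∣m d 12 (trans (sym (%24%12 d)) s%12)
      open Terms.Leaves (t₀ % 12 % 4) (t₀ % 12 % 3) t₀ d 2≤t₀ 1≤d
        (∣-trans (divides 3 refl) 12∣d) using (window)
      constant : ∀ k → term k % 12 ≡ t₀ % 12
      constant k with ∣n⇒∣m*n k 12∣d
      ... | divides e eq = trans (cong (λ m → (t₀ + m) % 12) eq) ([m+kn]%n≡m%n t₀ e 12)
      kind′ : ∀ k {k<7 : True (k N.<? 7)} → Terms.Kind (t₀ % 12 % 4) (t₀ % 12 % 3) (term k)
      kind′ k {k<7} =
        kind (at k {k<7}) (constant k) (subst (_∈ 1 ∷ 5 ∷ 7 ∷ 11 ∷ []) (%24%12 t₀) r%12)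

-- Passage to integers of either sign

open import Data.Integer using (ℤ; _+_; _*_; +_; -[1+_]; -_)
import Data.Integer.Properties as Int
open import Data.Integer.Tactic.RingSolver using (solve-∀)

no-increasing-terms : ∀ a n → ¬ (∀ k → k < 7 → InS (a + + k * + suc n))
no-increasing-terms a n S with S 0 z<s
... | x , y , a≡t₀ = Naturals.no-seven-terms (3 ^ x N.+ 2 ^ y) (suc n) (s≤s z≤n) summand
  where
  t₀ : ℕ
  t₀ = 3 ^ x N.+ 2 ^ y
  term : ∀ k → a + + k * + suc n ≡ + (t₀ N.+ k N.* suc n)
  term k = cong₂ _+_
    (trans (sym (trans (cong (λ z → a + z) (Int.*-zeroˡ (+ suc n))) (Int.+-identityʳ a))) a≡t₀)
    (sym (Int.pos-* k (suc n)))
  summand : ∀ k → k < 7 → Naturals.Summands (t₀ N.+ k N.* suc n)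
  summand k k<7 with S k k<7
  ... | u , v , eq =
    Naturals.summands (u , refl) (v , refl) (Int.+-injective (trans (sym (term k)) eq))

theorem1p1 : ¬ (∃₂ λ (a d : ℤ) → (d ≢ + 0) × ((k : ℕ) → k < 7 → InS (a + + k * d)))
theorem1p1 (a , + zero , d≢0 , S) = d≢0 refl
theorem1p1 (a , + suc n , d≢0 , S) = no-increasing-terms a n S
-- A decreasing progression is read backwards from its last term a + 6d; `- -[1+ n ]` computes to
-- `+ suc n`.
theorem1p1 (a , -[1+ n ] , d≢0 , S) = no-increasing-terms (a + + 6 * -[1+ n ]) n λ k k<7 →
  subst InS (trans (reverse a (+ (6 ∸ k)) (+ k) -[1+ n ])
      (cong (λ m → a + m * -[1+ n ] + + k * + suc n) (cong (λ m → + m) (m∸n+n≡m (≤-pred k<7)))))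
    (S (6 ∸ k) (s≤s (m∸n≤m 6 k)))
  where
  reverse : ∀ a j k d → a + j * d ≡ a + (j + k) * d + k * (- d)
  reverse = solve-∀
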